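{- There are extreme points of the polytopes $P_V$ (the feasible regions of the Held–Karp / subtour relaxation of TSP) with fractionality exponentially small in $|V|$ and whose support graph has maximum degree linear in $|V|$. Precisely: there exist constants $C>0$, $\alpha>1$, $\beta>0$ such that for infinitely many positive integers $n$ there is a vertex set $V$ with $|V|=n$ and an extreme point $x$ of $P_V$ such that the fractionality of $x$ is at most $C\alpha^{ -n}$ and the support graph of $x$ has maximum degree at least $\beta n$.
   Context: For a finite set $V$, let $E=\binom{V}{2}$ be the edge set of the complete graph on $V$. For $S\subseteq V$, $\delta(S)$ is the set of edges in $E$ with exactly one end in $S$, $\delta(v)=\delta(\{v\})$, and $x(A)=\sum_{e\in A}x_e$ for $A\subseteq E$. Define $$P_V=\{x\in\mathbb{R}^E:\ x(\delta(v))=2\ \ \forall v\in V;\quad x(\delta(S))\ge 2\ \ \forall\,\varnothing\ne S\subsetneq V;\quad x_e\ge 0\ \ \forall e\in E\}.$$ For $x\in P_V$, the support is $\{e\in E: x_e>0\}$; the support graph is the graph with vertex set $V$ and edge set the support; the fractionality of $x$ is $\min\{x_e: e\in E,\ x_e>0\}$. -}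

module Defs where

open import Algebra.Bundles.Raw using (RawSemiring)
import Algebra.Definitions.RawSemiring as RawSemiringDefs
open import Data.Bool.Base using (Bool; if_then_else_; _xor_)
open import Data.Fin.Base as Fin using (Fin)
open import Data.Fin.Properties using (_<?_)
open import Data.Fin.Subset using (Subset; Nonempty; _⊂_; ⊤; ⁅_⁆; _∈_; ∣_∣)
open import Data.Integer.Base using (+_)
open import Data.Nat.Base as ℕ using (ℕ)
import Data.Nat.Properties as ℕ
open import Data.Product using (Σ; ∃; _×_; _,_)
open import Data.Rational.Base as ℚ using (ℚ; 0ℚ; 1ℚ; ½; 1/_)
import Data.Rational.Properties as ℚ
open import Data.Rational.Solver using (module +-*-Solver)
open import Data.Sum.Base using (_⊎_)
open import Data.Vec.Base using (lookup)
open import Function.Bundles using (_⇔_)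
open import Level using (0ℓ)
open import Relation.Binary.PropositionalEquality
  using (_≡_; refl; sym; trans; cong; cong₂; subst)
open import Relation.Nullary using (yes; no; contradiction)

Eventually : (ℕ → Set) → Set
Eventually P = ∃ λ N → ∀ n → N ℕ.≤ n → P n

IsCauchy : (ℕ → ℚ) → Set
IsCauchy a = ∀ ε → 0ℚ ℚ.< ε →
  ∃ λ N → ∀ m n → N ℕ.≤ m → N ℕ.≤ n → ℚ.∣ a m ℚ.- a n ∣ ℚ.< ε

-- Two sequences denote the same real when they are related by _≈_ below.
record ℝ : Set where
  constructor mkℝ
  field
    seq    : ℕ → ℚ
    cauchy : IsCauchy seq

open ℝ public

infix 4 _≈_ _≤_ _<_

_≈_ : ℝ → ℝ → Set
x ≈ y = ∀ ε → 0ℚ ℚ.< ε → Eventually λ n → ℚ.∣ seq x n ℚ.- seq y n ∣ ℚ.< ε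

_≤_ : ℝ → ℝ → Set
x ≤ y = ∀ ε → 0ℚ ℚ.< ε → Eventually λ n → seq x n ℚ.≤ seq y n ℚ.+ ε

-- A pointwise strict inequality would not be invariant under _≈_, hence
-- the uniform gap.
_<_ : ℝ → ℝ → Set
x < y = ∃ λ ε → 0ℚ ℚ.< ε × Eventually λ n → seq x n ℚ.+ ε ℚ.≤ seq y n

fromℚ : ℚ → ℝ
fromℚ q = mkℝ (λ _ → q) λ ε 0<ε → 0 , λ _ _ _ _ →
  subst (λ d → ℚ.∣ d ∣ ℚ.< ε) (sym (ℚ.+-inverseʳ q)) 0<ε

fromℕ : ℕ → ℝ
fromℕ n = fromℚ (+ n ℚ./ 1)

0ℝ 1ℝ 2ℝ : ℝ
0ℝ = fromℚ 0ℚ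
1ℝ = fromℚ 1ℚ
2ℝ = fromℕ 2

module CauchySequences where
  open +-*-Solver using (solve; _:=_; _:+_; _:*_; _:-_; :-_)

  half-pos : ∀ {ε} → 0ℚ ℚ.< ε → 0ℚ ℚ.< ½ ℚ.* ε
  half-pos = ℚ.*-monoʳ-<-pos ½

  half-sum : ∀ ε → ½ ℚ.* ε ℚ.+ ½ ℚ.* ε ≡ ε
  half-sum ε = trans (sym (ℚ.*-distribʳ-+ ε ½ ½)) (ℚ.*-identityˡ ε)

  *-pos : ∀ {p q} → 0ℚ ℚ.< p → 0ℚ ℚ.< q → 0ℚ ℚ.< p ℚ.* q
  *-pos {p} {q} 0<p 0<q =
    ℚ.positive⁻¹ _ {{ℚ.pos*pos⇒pos p {{ℚ.positive 0<p}} q {{ℚ.positive 0<q}}}}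

  *-mono : ∀ {p q r s} → 0ℚ ℚ.≤ r → 0ℚ ℚ.≤ q → p ℚ.≤ q → r ℚ.≤ s →
           p ℚ.* r ℚ.≤ q ℚ.* s
  *-mono {p} {q} {r} {s} 0≤r 0≤q p≤q r≤s = ℚ.≤-trans
    (ℚ.*-monoʳ-≤-nonNeg r {{ℚ.nonNegative 0≤r}} p≤q)
    (ℚ.*-monoˡ-≤-nonNeg q {{ℚ.nonNegative 0≤q}} r≤s)

  inv : ℚ → ℚ
  inv q with q ℚ.≟ 0ℚ
  ... | yes _  = 0ℚ
  ... | no q≢0 = (1/ q) {{ℚ.≢-nonZero q≢0}}

  inv-inverse : ∀ {q} → 0ℚ ℚ.< q → q ℚ.* inv q ≡ 1ℚ
  inv-inverse {q} 0<q with q ℚ.≟ 0ℚ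
  ... | yes q≡0 = contradiction (sym q≡0) (ℚ.<⇒≢ 0<q)
  ... | no q≢0  = ℚ.*-inverseʳ q {{ℚ.≢-nonZero q≢0}}

  inv-pos : ∀ {q} → 0ℚ ℚ.< q → 0ℚ ℚ.< inv q
  inv-pos {q} 0<q with q ℚ.≟ 0ℚ
  ... | yes q≡0 = contradiction (sym q≡0) (ℚ.<⇒≢ 0<q)
  ... | no _    = ℚ.positive⁻¹ _ {{ℚ.1/pos⇒pos q {{ℚ.positive 0<q}}}}

  inv-anti : ∀ {p q} → 0ℚ ℚ.< p → p ℚ.≤ q → inv q ℚ.≤ inv p
  inv-anti {p} {q} 0<p p≤q = begin
    inv q                    ≡⟨ sym (ℚ.*-identityʳ _) ⟩
    inv q ℚ.* 1ℚ             ≡⟨ cong (inv q ℚ.*_) (sym (inv-inverse 0<p)) ⟩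
    inv q ℚ.* (p ℚ.* inv p)  ≤⟨ ℚ.*-monoˡ-≤-nonNeg (inv q) {{≥0 (inv-pos 0<q)}}
                                (ℚ.*-monoʳ-≤-nonNeg (inv p) {{≥0 (inv-pos 0<p)}} p≤q) ⟩
    inv q ℚ.* (q ℚ.* inv p)  ≡⟨ solve 3 (λ a b c → a :* (b :* c) := (b :* a) :* c)
                                  refl (inv q) q (inv p) ⟩
    (q ℚ.* inv q) ℚ.* inv p  ≡⟨ cong (ℚ._* inv p) (inv-inverse 0<q) ⟩
    1ℚ ℚ.* inv p             ≡⟨ ℚ.*-identityˡ _ ⟩
    inv p                    ∎
    where
    open ℚ.≤-Reasoning
    0<q = ℚ.<-≤-trans 0<p p≤q
    ≥0 : ∀ {r} → 0ℚ ℚ.< r → ℚ.NonNegative r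
    ≥0 0<r = ℚ.nonNegative (ℚ.<⇒≤ 0<r)

  scale-inv : ∀ {b} c → 0ℚ ℚ.< b → b ℚ.* (inv b ℚ.* c) ≡ c
  scale-inv {b} c 0<b = trans (sym (ℚ.*-assoc b (inv b) c))
    (trans (cong (ℚ._* c) (inv-inverse 0<b)) (ℚ.*-identityˡ c))

  bounded : ∀ {a} → IsCauchy a →
            ∃ λ B → 0ℚ ℚ.< B × Eventually λ n → ℚ.∣ a n ∣ ℚ.≤ B
  bounded {a} ca with N , p ← ca 1ℚ (ℚ.positive⁻¹ 1ℚ) =
    1ℚ ℚ.+ ℚ.∣ a N ∣ ,
    ℚ.positive⁻¹ _ {{ℚ.pos+nonNeg⇒pos 1ℚ ℚ.∣ a N ∣ {{ℚ.∣-∣-nonNeg (a N)}}}} ,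
    N , λ n N≤n → begin
      ℚ.∣ a n ∣                          ≡⟨ cong ℚ.∣_∣ (solve 2 (λ s t → s := (s :- t) :+ t)
                                              refl (a n) (a N)) ⟩
      ℚ.∣ (a n ℚ.- a N) ℚ.+ a N ∣        ≤⟨ ℚ.∣p+q∣≤∣p∣+∣q∣ (a n ℚ.- a N) (a N) ⟩
      ℚ.∣ a n ℚ.- a N ∣ ℚ.+ ℚ.∣ a N ∣    ≤⟨ ℚ.+-monoˡ-≤ ℚ.∣ a N ∣
                                              (ℚ.<⇒≤ (p n N N≤n ℕ.≤-refl)) ⟩
      1ℚ ℚ.+ ℚ.∣ a N ∣                   ∎
    where open ℚ.≤-Reasoning

  abstract
    +-cauchy : ∀ {a b} → IsCauchy a → IsCauchy b → IsCauchy (λ n → a n ℚ.+ b n)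
    +-cauchy {a} {b} ca cb ε 0<ε
      with M , p ← ca (½ ℚ.* ε) (half-pos 0<ε)
         | N , q ← cb (½ ℚ.* ε) (half-pos 0<ε) =
      M ℕ.⊔ N , λ m n m≥ n≥ → begin-strict
        ℚ.∣ (a m ℚ.+ b m) ℚ.- (a n ℚ.+ b n) ∣
          ≡⟨ cong ℚ.∣_∣ (solve 4 (λ s t u v → (s :+ t) :- (u :+ v) := (s :- u) :+ (t :- v))
               refl (a m) (b m) (a n) (b n)) ⟩
        ℚ.∣ (a m ℚ.- a n) ℚ.+ (b m ℚ.- b n) ∣
          ≤⟨ ℚ.∣p+q∣≤∣p∣+∣q∣ (a m ℚ.- a n) (b m ℚ.- b n) ⟩
        ℚ.∣ a m ℚ.- a n ∣ ℚ.+ ℚ.∣ b m ℚ.- b n ∣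
          <⟨ ℚ.+-mono-< (p m n (ℕ.m⊔n≤o⇒m≤o M N m≥) (ℕ.m⊔n≤o⇒m≤o M N n≥))
                        (q m n (ℕ.m⊔n≤o⇒n≤o M N m≥) (ℕ.m⊔n≤o⇒n≤o M N n≥)) ⟩
        ½ ℚ.* ε ℚ.+ ½ ℚ.* ε
          ≡⟨ half-sum ε ⟩
        ε ∎
      where open ℚ.≤-Reasoning

  abstract
    neg-cauchy : ∀ {a} → IsCauchy a → IsCauchy (λ n → ℚ.- a n)
    neg-cauchy {a} ca ε 0<ε with N , p ← ca ε 0<ε =
      N , λ m n m≥ n≥ → subst (ℚ._< ε)
        (sym (trans (cong ℚ.∣_∣ (solve 2 (λ s t → (:- s) :- (:- t) := :- (s :- t))
                                  refl (a m) (a n)))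
                    (ℚ.∣-p∣≡∣p∣ (a m ℚ.- a n))))
        (p m n m≥ n≥)

  *-close : ∀ {A B} s t u v h → 0ℚ ℚ.< A → 0ℚ ℚ.< B →
            ℚ.∣ s ∣ ℚ.≤ A → ℚ.∣ v ∣ ℚ.≤ B →
            ℚ.∣ s ℚ.- u ∣ ℚ.< inv B ℚ.* h → ℚ.∣ t ℚ.- v ∣ ℚ.< inv A ℚ.* h →
            ℚ.∣ s ℚ.* t ℚ.- u ℚ.* v ∣ ℚ.< h ℚ.+ h
  *-close {A} {B} s t u v h 0<A 0<B s≤A v≤B su tv = begin-strict
    ℚ.∣ s ℚ.* t ℚ.- u ℚ.* v ∣
      ≡⟨ cong ℚ.∣_∣ (solve 4 (λ s t u v →
           s :* t :- u :* v := s :* (t :- v) :+ v :* (s :- u)) refl s t u v) ⟩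
    ℚ.∣ s ℚ.* (t ℚ.- v) ℚ.+ v ℚ.* (s ℚ.- u) ∣
      ≤⟨ ℚ.∣p+q∣≤∣p∣+∣q∣ (s ℚ.* (t ℚ.- v)) (v ℚ.* (s ℚ.- u)) ⟩
    ℚ.∣ s ℚ.* (t ℚ.- v) ∣ ℚ.+ ℚ.∣ v ℚ.* (s ℚ.- u) ∣
      ≡⟨ cong₂ ℚ._+_ (ℚ.∣p*q∣≡∣p∣*∣q∣ s (t ℚ.- v)) (ℚ.∣p*q∣≡∣p∣*∣q∣ v (s ℚ.- u)) ⟩
    ℚ.∣ s ∣ ℚ.* ℚ.∣ t ℚ.- v ∣ ℚ.+ ℚ.∣ v ∣ ℚ.* ℚ.∣ s ℚ.- u ∣
      ≤⟨ ℚ.+-mono-≤ (*-mono (ℚ.0≤∣p∣ (t ℚ.- v)) (ℚ.<⇒≤ 0<A) s≤A ℚ.≤-refl)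
                    (*-mono (ℚ.0≤∣p∣ (s ℚ.- u)) (ℚ.<⇒≤ 0<B) v≤B ℚ.≤-refl) ⟩
    A ℚ.* ℚ.∣ t ℚ.- v ∣ ℚ.+ B ℚ.* ℚ.∣ s ℚ.- u ∣
      <⟨ ℚ.+-mono-< (ℚ.*-monoʳ-<-pos A {{ℚ.positive 0<A}} tv)
                    (ℚ.*-monoʳ-<-pos B {{ℚ.positive 0<B}} su) ⟩
    A ℚ.* (inv A ℚ.* h) ℚ.+ B ℚ.* (inv B ℚ.* h)
      ≡⟨ cong₂ ℚ._+_ (scale-inv h 0<A) (scale-inv h 0<B) ⟩
    h ℚ.+ h ∎
    where open ℚ.≤-Reasoning

  abstract
    *-cauchy : ∀ {a b} → IsCauchy a → IsCauchy b → IsCauchy (λ n → a n ℚ.* b n)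
    *-cauchy {a} {b} ca cb ε 0<ε =
      let A , 0<A , K , bA = bounded ca
          B , 0<B , L , bB = bounded cb
          h = ½ ℚ.* ε
          M , p = ca (inv B ℚ.* h) (*-pos (inv-pos 0<B) (half-pos 0<ε))
          N , q = cb (inv A ℚ.* h) (*-pos (inv-pos 0<A) (half-pos 0<ε))
      in (K ℕ.⊔ L) ℕ.⊔ (M ℕ.⊔ N) , λ m n m≥ n≥ →
        let m≥KL = ℕ.m⊔n≤o⇒m≤o (K ℕ.⊔ L) (M ℕ.⊔ N) m≥
            n≥KL = ℕ.m⊔n≤o⇒m≤o (K ℕ.⊔ L) (M ℕ.⊔ N) n≥
            m≥MN = ℕ.m⊔n≤o⇒n≤o (K ℕ.⊔ L) (M ℕ.⊔ N) m≥
            n≥MN = ℕ.m⊔n≤o⇒n≤o (K ℕ.⊔ L) (M ℕ.⊔ N) n≥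
        in subst (ℚ.∣ a m ℚ.* b m ℚ.- a n ℚ.* b n ∣ ℚ.<_) (half-sum ε)
          (*-close (a m) (b m) (a n) (b n) h 0<A 0<B
            (bA m (ℕ.m⊔n≤o⇒m≤o K L m≥KL)) (bB n (ℕ.m⊔n≤o⇒n≤o K L n≥KL))
            (p m n (ℕ.m⊔n≤o⇒m≤o M N m≥MN) (ℕ.m⊔n≤o⇒m≤o M N n≥MN))
            (q m n (ℕ.m⊔n≤o⇒n≤o M N m≥MN) (ℕ.m⊔n≤o⇒n≤o M N n≥MN)))

  abstract
    inv-cauchy : ∀ {a} → IsCauchy a → ∀ {d} → 0ℚ ℚ.< d →
                 Eventually (λ n → d ℚ.≤ a n) → IsCauchy (λ n → inv (a n))
    inv-cauchy {a} ca {d} 0<d (M , d≤) ε 0<ε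
      with N , p ← ca (d ℚ.* (d ℚ.* ε)) (*-pos 0<d (*-pos 0<d 0<ε)) =
      M ℕ.⊔ N , λ m n m≥ n≥ →
        let d≤m = d≤ m (ℕ.m⊔n≤o⇒m≤o M N m≥)
            d≤n = d≤ n (ℕ.m⊔n≤o⇒m≤o M N n≥)
            s   = inv (a m)
            t   = inv (a n)
            0<s = inv-pos (ℚ.<-≤-trans 0<d d≤m)
            0<t = inv-pos (ℚ.<-≤-trans 0<d d≤n)
            i   = inv d
            0<i = inv-pos 0<d
        in begin-strict
        ℚ.∣ s ℚ.- t ∣
          ≡⟨ cong ℚ.∣_∣ (trans
               (cong₂ ℚ._-_ (sym (ℚ.*-identityˡ s)) (sym (ℚ.*-identityˡ t)))
               (trans
                 (cong₂ (λ k l → k ℚ.* s ℚ.- l ℚ.* t)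
                   (sym (inv-inverse (ℚ.<-≤-trans 0<d d≤n)))
                   (sym (inv-inverse (ℚ.<-≤-trans 0<d d≤m))))
                 (solve 4 (λ s t u v → (v :* t) :* s :- (u :* s) :* t :=
                                       (s :* t) :* (v :- u))
                   refl s t (a m) (a n)))) ⟩
        ℚ.∣ (s ℚ.* t) ℚ.* (a n ℚ.- a m) ∣
          ≡⟨ trans (ℚ.∣p*q∣≡∣p∣*∣q∣ (s ℚ.* t) (a n ℚ.- a m))
               (cong (ℚ._* ℚ.∣ a n ℚ.- a m ∣)
                 (ℚ.0≤p⇒∣p∣≡p (ℚ.<⇒≤ (*-pos 0<s 0<t)))) ⟩
        (s ℚ.* t) ℚ.* ℚ.∣ a n ℚ.- a m ∣
          ≤⟨ *-mono (ℚ.0≤∣p∣ (a n ℚ.- a m)) (ℚ.<⇒≤ (*-pos 0<i 0<i))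
               (*-mono (ℚ.<⇒≤ 0<t) (ℚ.<⇒≤ 0<i) (inv-anti 0<d d≤m) (inv-anti 0<d d≤n))
               ℚ.≤-refl ⟩
        (i ℚ.* i) ℚ.* ℚ.∣ a n ℚ.- a m ∣
          <⟨ ℚ.*-monoʳ-<-pos (i ℚ.* i) {{ℚ.positive (*-pos 0<i 0<i)}}
               (p n m (ℕ.m⊔n≤o⇒n≤o M N n≥) (ℕ.m⊔n≤o⇒n≤o M N m≥)) ⟩
        (i ℚ.* i) ℚ.* (d ℚ.* (d ℚ.* ε))
          ≡⟨ solve 3 (λ i d e → (i :* i) :* (d :* (d :* e)) :=
                                d :* (i :* (d :* (i :* e)))) refl i d ε ⟩
        d ℚ.* (i ℚ.* (d ℚ.* (i ℚ.* ε)))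
          ≡⟨ trans (scale-inv _ 0<d) (scale-inv ε 0<d) ⟩
        ε ∎
      where open ℚ.≤-Reasoning

open CauchySequences

infixl 6 _+_ _-_
infixl 7 _*_
infix  8 -_

_+_ : ℝ → ℝ → ℝ
x + y = mkℝ (λ n → seq x n ℚ.+ seq y n) (+-cauchy {seq x} {seq y} (cauchy x) (cauchy y))

-_ : ℝ → ℝ
- x = mkℝ (λ n → ℚ.- seq x n) (neg-cauchy {seq x} (cauchy x))

_-_ : ℝ → ℝ → ℝ
x - y = x + (- y)

_*_ : ℝ → ℝ → ℝ
x * y = mkℝ (λ n → seq x n ℚ.* seq y n) (*-cauchy {seq x} {seq y} (cauchy x) (cauchy y))

-- The finitely many zero terms that may occur are sent to zero.
recip : (x : ℝ) → 0ℝ < x → ℝ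
recip x (ε , 0<ε , N , p) = mkℝ (λ n → inv (seq x n))
  (inv-cauchy {seq x} (cauchy x) 0<ε
    (N , λ n N≤n → subst (ℚ._≤ seq x n) (ℚ.+-identityˡ ε) (p n N≤n)))

1<⇒0< : ∀ x → 1ℝ < x → 0ℝ < x
1<⇒0< _ (ε , 0<ε , N , p) =
  ε , 0<ε , N , λ n N≤n →
    ℚ.≤-trans (ℚ.+-monoˡ-≤ ε (ℚ.<⇒≤ (ℚ.positive⁻¹ 1ℚ))) (p n N≤n)

ℝ-rawSemiring : RawSemiring 0ℓ 0ℓ
ℝ-rawSemiring = record
  { Carrier = ℝ ; _≈_ = _≈_ ; _+_ = _+_ ; _*_ = _*_ ; 0# = 0ℝ ; 1# = 1ℝ }

open RawSemiringDefs ℝ-rawSemiring public using (sum; _^_)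

-- An unordered pair of distinct vertices is stored in increasing order.
record Edge (n : ℕ) : Set where
  constructor edge
  field
    lo hi  : Fin n
    .lo<hi : lo Fin.< hi

open Edge public using (lo; hi)

EdgeSet : ℕ → Set
EdgeSet n = Edge n → Bool

δ : ∀ {n} → Subset n → EdgeSet n
δ S e = lookup S (lo e) xor lookup S (hi e)

entry : ∀ {n} → (Edge n → ℝ) → EdgeSet n → Fin n → Fin n → ℝ
entry x A i j with i <? j
... | yes i<j = if A (edge i j i<j) then x (edge i j i<j) else 0ℝ
... | no  _   = 0ℝ

-- The sum usually written x(A).
infix 9 _⟨_⟩

_⟨_⟩ : ∀ {n} → (Edge n → ℝ) → EdgeSet n → ℝ
x ⟨ A ⟩ = sum λ i → sum λ j → entry x A i j

record SubtourPolytope (n : ℕ) (x : Edge n → ℝ) : Set where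
  field
    degree : ∀ v → x ⟨ δ ⁅ v ⁆ ⟩ ≈ 2ℝ
    cut    : ∀ S → Nonempty S → S ⊂ ⊤ → 2ℝ ≤ x ⟨ δ S ⟩
    nonneg : ∀ e → 0ℝ ≤ x e

IsExtremePoint : ∀ {I : Set} → ((I → ℝ) → Set) → (I → ℝ) → Set
IsExtremePoint K x = K x ×
  (∀ y z t → K y → K z → 0ℝ < t → t < 1ℝ →
    (∀ i → x i ≈ t * y i + (1ℝ - t) * z i) →
    (∀ i → y i ≈ x i) × (∀ i → z i ≈ x i))

Support : ∀ {n} → (Edge n → ℝ) → Edge n → Set
Support x e = 0ℝ < x e

IsFractionality : ∀ {n} → (Edge n → ℝ) → ℝ → Set
IsFractionality x f =
  (∃ λ e → Support x e × f ≈ x e) × (∀ e → Support x e → f ≤ x e)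

Graph : ℕ → Set₁
Graph n = Edge n → Set

Adjacent : ∀ {n} → Graph n → Fin n → Fin n → Set
Adjacent G u v = ∃ λ e → G e ×
  ((lo e ≡ u × hi e ≡ v) ⊎ (lo e ≡ v × hi e ≡ u))

-- Positivity of a real is not decidable, so degrees are relations rather
-- than functions of the graph.
HasDegree : ∀ {n} → Graph n → Fin n → ℕ → Set
HasDegree {n} G v d = Σ (Subset n) λ N →
  (∀ w → w ∈ N ⇔ Adjacent G v w) × ∣ N ∣ ≡ d

IsMaxDegree : ∀ {n} → Graph n → ℕ → Set
IsMaxDegree G Δ =
  (∃ λ v → HasDegree G v Δ) × (∀ v d → HasDegree G v d → d ℕ.≤ Δ)

{-# OPTIONS --safe #-}

-- The extreme points are weighted graphs on 3m + 3 vertices: a root s, vertices c_k, u_k, v_k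
-- for k < m, and two last vertices c_m, u_m.  With a_k = 2^(k - m), the edges are
--   s c_0 (1),  s u_0 (a_0),  c_m u_m (1),  and, for k < m,
--   c_k v_k (1 - a_k),  u_k v_k (1),  u_k c_{k+1} (1 - a_k),
--   c_k u_{k+1} (a_k),  v_k u_{k+1} (a_k),  s c_{k+1} (a_k).
-- The root is adjacent to every c_k, and the edge s u_0 has value 2^(-m).
-- Contracting s, c_0, u_0, v_0 to one vertex doubles a_0 and yields the graph for m - 1.
-- Hence cut values satisfy a recursion in m: the cut inequalities follow by dynamic
-- programming over the levels, and a point tight on the same cuts is determined level by level,
-- starting from the contracted graph.
module Submission where

open import Algebra.Bundles using (CommutativeMonoid; CommutativeRing)
open import Algebra.Construct.DirectProduct using (commutativeMonoid)
open import Algebra.Core using (Op₂)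
import Algebra.Definitions.RawMonoid as RawMonoidDefs
import Algebra.Properties.CommutativeMonoid.Sum as Sum
import Algebra.Properties.Monoid.Mult as Mult
open import Data.Bool.Base using (Bool; true; false; if_then_else_; _xor_; _∨_)
open import Data.Bool.Properties using (not-involutive; ¬-not; xor-identityʳ; ∨-zeroʳ)
open import Data.Fin.Base as Fin using (Fin; zero; suc)
open import Data.Fin.Patterns
import Data.Fin.Properties as Fin
open import Data.Fin.Subset using (Subset; Nonempty; _⊂_; ⊤; ⁅_⁆; _∈_; ∣_∣)
import Data.Fin.Subset.Properties as Subset
open import Data.Integer.Base as ℤ using (+_)
import Data.Integer.Properties as ℤ
open import Data.Nat.Base as ℕ using (ℕ; zero; suc; z≤n; s≤s)
import Data.Nat.Properties as ℕ
open import Data.Nat.Tactic.RingSolver using (solve-∀)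
open import Data.Product using (Σ; ∃; _×_; _,_; proj₁; proj₂)
open import Data.Rational.Base as ℚ using (ℚ; 0ℚ; 1ℚ; ½)
import Data.Rational.Properties as ℚ
open import Data.Rational.Solver using (module +-*-Solver)
open import Data.Rational.Unnormalised.Base as ℚᵘ using (mkℚᵘ)
import Data.Rational.Unnormalised.Properties as ℚᵘ
open import Data.Sum.Base using (inj₁; inj₂)
open import Data.Vec.Base as Vec using (lookup; tabulate)
open import Data.Vec.Functional using (Vector; _∷_)
import Data.Vec.Properties as Vec
open import Function.Bundles using (_⇔_; mk⇔; Equivalence)
open import Level using (0ℓ)
import Relation.Binary.Reasoning.Setoid as SetoidReasoning
open import Relation.Binary.PropositionalEquality as ≡ using (_≡_)
open import Relation.Binary.Structures using (IsEquivalence)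
open import Relation.Nullary using (Dec; yes; no; does; contradiction)
open import Relation.Nullary.Decidable using (dec-true; from-yes; map′; _×-dec_)
open import Relation.Nullary.Negation.Core using (contradiction-irr)

-- Why contraction doubles `a_0`: the edges `c_0 u_1` and `v_0 u_1`, each of value `a_0`, become
-- parallel and merge to `2 a_0`, while `s c_1` and `u_0 c_1` merge to `a_0 + (1 - a_0) = 1`. After
-- `m` contractions a triangle with all values 1 is left. There are `6m + 3` edges and equally many
-- tight cuts, three for the triangle and six for each level, so there are just enough equations for
-- uniqueness. Positivity of a Cauchy real is undecidable, so the cut inequalities are proved for
-- integer weights and carried to the reals by an additive map. Sums over cuts are therefore set up
-- over any commutative monoid. Uniqueness is proved there too, assuming that `x + x = 0` forces
-- `x = 0`; in place of subtraction, each elimination is an identity between sums, most of which are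
-- known to vanish. For the inequalities the unit is written `2A + r`. All edge values of a level
-- are then combinations of `A` and `r` with natural coefficients, and a step of the dynamic program
-- is a finite comparison of coefficients.

pattern 3+ i = suc (suc (suc i))
pattern 4+ i = suc (3+ i)
pattern 5+ i = suc (4+ i)
pattern 6+ i = suc (5+ i)

-- The weighted graphs and their tight cuts

order : ℕ → ℕ
order m = 3 ℕ.+ m ℕ.* 3

Vertex : ℕ → Set
Vertex m = Fin (order m)

-- The values are scaled by unit m A = 2^m A, so that 1 becomes unit m A, and a_0 becomes A.
-- The vertices are numbered in the order s, c_0, u_0, v_0, c_1, u_1, v_1, …
unit : ℕ → ℕ → ℕ
unit zero    A = A
unit (suc m) A = unit m (A ℕ.+ A)

weight : ∀ m → ℕ → Vertex m → Vertex m → ℕ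
weight zero A 0F 1F = A
weight zero A 0F 2F = A
weight zero A 1F 2F = A
weight zero A _  _  = 0
weight (suc m) A 0F 1F = unit (suc m) A
weight (suc m) A 0F 2F = A
weight (suc m) A 1F 3F = unit (suc m) A ℕ.∸ A
weight (suc m) A 2F 3F = unit (suc m) A
weight (suc m) A 2F 4F = unit (suc m) A ℕ.∸ A
weight (suc m) A 1F 5F = A
weight (suc m) A 3F 5F = A
weight (suc m) A 0F 4F = A
-- From here on the entries are those of the contracted graph, in which `c_1` and `u_1` have the
-- indices 1 and 2. Its entries (0,1) and (0,2) come from merged edges, so the root row is shared
-- only beyond `u_1`.
weight (suc m) A 0F (6+ j) = weight m (A ℕ.+ A) 0F (3+ j)
weight (suc m) A (4+ i) (4+ j) = weight m (A ℕ.+ A) (suc i) (suc j)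
weight (suc m) A _ _ = 0

-- Vertices of the contracted graph as vertices of the graph itself.
expand : ∀ {n} → Fin (suc n) → Fin (4 ℕ.+ n)
expand zero    = zero
expand (suc i) = 4+ i

-- The entries (0,1) and (0,2), that is s c_0 and s u_0, are left out.
levelSum : ∀ {a} {X : Set a} → Op₂ X → ∀ m → (Vertex m → Vertex m → X) → X
levelSum _+_ zero    M = M 1F 2F
levelSum _+_ (suc m) M = M 1F 3F + (M 2F 3F + (M 2F 4F + (M 1F 5F + (M 3F 5F +
  (M 0F 4F + levelSum _+_ m λ i j → M (expand i) (expand j))))))

-- A cut is given by its side ζ that avoids the root.
rooted : ∀ {n} → Vector Bool n → Vector Bool (suc n)
rooted ζ = false ∷ ζ

zeros ones : ∀ {n} → Vector Bool n
zeros _ = false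
ones  _ = true

-- all-tight and but-c-tight are the complements of {s} and {s , c_0}.
data Tight : ∀ m → Vector Bool (2 ℕ.+ m ℕ.* 3) → Set where
  c-tight     : ∀ {m} → Tight m (true ∷ zeros)
  u-tight     : ∀ {m} → Tight m (false ∷ true ∷ zeros)
  v-tight     : ∀ {m} → Tight (suc m) (false ∷ false ∷ true ∷ zeros)
  uv-tight    : ∀ {m} → Tight (suc m) (false ∷ true ∷ true ∷ zeros)
  all-tight   : ∀ {m} → Tight m ones
  but-c-tight : ∀ {m} → Tight (suc m) (false ∷ ones)
  later-tight : ∀ {m ζ} → Tight m ζ → Tight (suc m) (false ∷ false ∷ false ∷ ζ)

-- Sums over cuts in a commutative monoid

module Cuts {c ℓ} (M : CommutativeMonoid c ℓ) where
  open CommutativeMonoid M renaming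
    ( _∙_ to _+_; ε to 0#; identityˡ to +-identityˡ; identityʳ to +-identityʳ
    ; ∙-cong to +-cong; ∙-congˡ to +-congˡ; ∙-congʳ to +-congʳ)
  open Sum M using (sum; sum-cong-≋; sum-replicate-zero)
  open import Algebra.Solver.CommutativeMonoid M
  open import Relation.Binary.Reasoning.Setoid setoid

  Matrix : ℕ → Set c
  Matrix n = Fin n → Fin n → Carrier

  cut : Bool → Bool → Carrier → Carrier
  cut a b x = if a xor b then x else 0#

  cuts : ∀ {n} → Vector Bool n → Matrix n → Matrix n
  cuts z W i j = cut (z i) (z j) (W i j)

  -- The values `d₁` of `s c_0` and `d₂` of `s u_0` are separate arguments: contraction replaces
  -- them, whereas `W` is merely re-indexed.
  cost : ∀ m → Vector Bool (2 ℕ.+ m ℕ.* 3) → Carrier → Carrier → Matrix (order m) → Carrier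
  cost m ζ d₁ d₂ W =
    cut false (ζ 0F) d₁ + (cut false (ζ 1F) d₂ + levelSum _+_ m (cuts (rooted ζ) W))

  -- One unfolding of `levelSum` on a cut, with `t` for the later levels. The sides of the five
  -- vertices are explicit Booleans, so that all of them can be enumerated.
  level : (c u v c′ u′ : Bool) (N K A t : Carrier) → Carrier
  level c u v c′ u′ N K A t = cut c v K + (cut u v N + (cut u c′ K +
    (cut c u′ A + (cut v u′ A + (cut false c′ A + t)))))

  cut-zero : ∀ a b {x} → x ≈ 0# → cut a b x ≈ 0#
  cut-zero a b x≈0 with a xor b
  ... | true  = x≈0
  ... | false = refl

  cut-+ : ∀ a b x y → cut a b (x + y) ≈ cut a b x + cut a b y
  cut-+ a b x y with a xor b
  ... | true  = refl
  ... | false = sym (+-identityˡ 0#)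

  -- The entries (0,1) and (0,2) are left free because contraction changes them.
  record _≋_ {n} (U W : Matrix (3 ℕ.+ n)) : Set ℓ where
    constructor _,_
    field
      fromRoot : ∀ j → U 0F (3+ j) ≈ W 0F (3+ j)
      rest     : ∀ i j → U (suc i) (suc j) ≈ W (suc i) (suc j)

  open _≋_

  O : ∀ {n} → Matrix n
  O _ _ = 0#

  expanded : ∀ {n} → Matrix (6 ℕ.+ n) → Matrix (3 ℕ.+ n)
  expanded W i j = W (expand i) (expand j)

  expanded-cong : ∀ {n} {U W : Matrix (6 ℕ.+ n)} → U ≋ W → expanded U ≋ expanded W
  expanded-cong (p , q) = (λ j → p (3+ j)) , λ i j → q (3+ i) (3+ j)

  levelSum-cong : ∀ m {U W} → U ≋ W → levelSum _+_ m U ≈ levelSum _+_ m W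
  levelSum-cong zero    e = rest e 0F 1F
  levelSum-cong (suc m) e@(p , q) = +-cong (q 0F 2F) (+-cong (q 1F 2F) (+-cong (q 1F 3F)
    (+-cong (q 0F 4F) (+-cong (q 2F 4F) (+-cong (p 1F) (levelSum-cong m (expanded-cong e)))))))

  levelSum-zero : ∀ m {W} → W ≋ O → levelSum _+_ m W ≈ 0#
  levelSum-zero m e = trans (levelSum-cong m e) (zero-levels m)
    where
    zero-levels : ∀ m → levelSum _+_ m O ≈ 0#
    zero-levels zero    = refl
    zero-levels (suc m) = trans (+-congˡ (+-congˡ (+-congˡ (+-congˡ (+-congˡ (+-congˡ
      (zero-levels m))))))) (solve 0 (id ⊕ (id ⊕ (id ⊕ (id ⊕ (id ⊕ (id ⊕ id))))) ⊜ id) refl)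

  cuts-zero : ∀ {n} (z : Vector Bool (3 ℕ.+ n)) {W} → W ≋ O → cuts z W ≋ O
  cuts-zero z (p , q) = (λ j → cut-zero (z 0F) (z _) (p j)) ,
    λ i j → cut-zero (z (suc i)) (z (suc j)) (q i j)

  -- Support contained in the edges of the graph. Since `weight` reduces to 0 on each non-edge,
  -- `≡.refl` serves as the proof there.
  Sparse : ∀ m → ℕ → Matrix (order m) → Set ℓ
  Sparse m A W =
    (∀ j → weight m A 0F (3+ j) ≡ 0 → W 0F (3+ j) ≈ 0#) ×
    (∀ i j → weight m A (suc i) (suc j) ≡ 0 → W (suc i) (suc j) ≈ 0#)

  expanded-sparse : ∀ m {A W} → Sparse (suc m) A W → Sparse m (A ℕ.+ A) (expanded W)
  expanded-sparse m (p , q) = (λ j → p (3+ j)) , λ i j → q (3+ i) (3+ j)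

  cuts-sparse : ∀ m {A} z {W} → Sparse m A W → Sparse m A (cuts z W)
  cuts-sparse m z (p , q) = (λ j w → cut-zero (z 0F) (z _) (p j w)) ,
    λ i j w → cut-zero (z (suc i)) (z (suc j)) (q i j w)

  sum-zero : ∀ {n} {f : Vector Carrier n} → (∀ i → f i ≈ 0#) → sum f ≈ 0#
  sum-zero {n} f≈0 = trans (sum-cong-≋ f≈0) (sum-replicate-zero n)

  +-zeroˡ : ∀ {x y} → x ≈ 0# → x + y ≈ y
  +-zeroˡ x≈0 = trans (+-congʳ x≈0) (+-identityˡ _)

  +-zeroʳ : ∀ {x y} → y ≈ 0# → x + y ≈ x
  +-zeroʳ y≈0 = trans (+-congˡ y≈0) (+-identityʳ _)

  sum-tail : ∀ {n} (f : Vector Carrier (suc n)) → f zero ≈ 0# → sum f ≈ sum (λ j → f (suc j))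
  sum-tail f = +-zeroˡ

  total : ∀ {n} → Matrix n → Carrier
  total W = sum λ i → sum λ j → W i j

  -- Row by row only the six edges of the first level survive; the remaining block, with the rest of
  -- the root row, is the same sum for the contracted graph.
  total-rest : ∀ m {A W} → Sparse m A W →
    sum (λ j → W 0F (3+ j)) + total (λ i j → W (suc i) (suc j)) ≈ levelSum _+_ m W
  total-rest zero {A} {W} (p , q) =
    trans (+-identityˡ _) (trans (+-cong
      (+-zeroˡ (q 0F 0F ≡.refl)) (+-zeroʳ refl)) (trans (+-congˡ
      (trans (+-zeroˡ (q 1F 0F ≡.refl)) (+-zeroˡ (q 1F 1F ≡.refl))))
      (trans (+-identityʳ _) (+-identityʳ _))))
  total-rest (suc m) {A} {W} (p , q) = begin
    (W 0F 3F + (W 0F 4F + (W 0F 5F + R))) + (r₁ + (r₂ + (r₃ + T)))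
      ≈⟨ +-cong (trans (+-zeroˡ (p 0F ≡.refl)) (+-congˡ (+-zeroˡ (p 2F ≡.refl))))
           (+-cong row₁ (+-cong row₂ (+-cong row₃ (sum-cong-≋ laterRow)))) ⟩
    (W 0F 4F + R) + ((W 1F 3F + W 1F 5F) + ((W 2F 3F + W 2F 4F) + (W 3F 5F + T′)))
      ≈⟨ solve 8 (λ a b c d e f r t →
           (f ⊕ r) ⊕ ((a ⊕ d) ⊕ ((b ⊕ c) ⊕ (e ⊕ t))) ⊜
           a ⊕ (b ⊕ (c ⊕ (d ⊕ (e ⊕ (f ⊕ (r ⊕ t))))))) refl
           (W 1F 3F) (W 2F 3F) (W 2F 4F) (W 1F 5F) (W 3F 5F) (W 0F 4F) R T′ ⟩
    W 1F 3F + (W 2F 3F + (W 2F 4F + (W 1F 5F + (W 3F 5F + (W 0F 4F + (R + T′))))))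
      ≈⟨ +-congˡ (+-congˡ (+-congˡ (+-congˡ (+-congˡ (+-congˡ
           (total-rest m (expanded-sparse m {A} {W} (p , q)))))))) ⟩
    levelSum _+_ (suc m) W ∎
    where
    R  = sum λ j → W 0F (6+ j)
    r₁ = sum λ j → W 1F (suc j)
    r₂ = sum λ j → W 2F (suc j)
    r₃ = sum λ j → W 3F (suc j)
    T  = sum λ i → sum λ j → W (4+ i) (suc j)
    T′ = total λ i j → W (4+ i) (4+ j)
    laterRow : ∀ i → sum (λ j → W (4+ i) (suc j)) ≈
                     sum (λ j → W (4+ i) (4+ j))
    laterRow i = trans (+-zeroˡ (q (3+ i) 0F ≡.refl))
      (trans (+-zeroˡ (q (3+ i) 1F ≡.refl))
        (+-zeroˡ (q (3+ i) 2F ≡.refl)))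
    row₁ : r₁ ≈ W 1F 3F + W 1F 5F
    row₁ = trans (+-zeroˡ (q 0F 0F ≡.refl)) (trans (+-zeroˡ (q 0F 1F ≡.refl))
      (+-congˡ (trans (+-zeroˡ (q 0F 3F ≡.refl))
        (+-zeroʳ (sum-zero λ j → q 0F (5+ j) ≡.refl)))))
    row₂ : r₂ ≈ W 2F 3F + W 2F 4F
    row₂ = trans (+-zeroˡ (q 1F 0F ≡.refl)) (trans (+-zeroˡ (q 1F 1F ≡.refl))
      (+-congˡ (trans (+-congˡ (+-zeroˡ (q 1F 4F ≡.refl)))
        (+-zeroʳ (sum-zero λ j → q 1F (5+ j) ≡.refl)))))
    row₃ : r₃ ≈ W 3F 5F
    row₃ = trans (+-zeroˡ (q 2F 0F ≡.refl)) (trans (+-zeroˡ (q 2F 1F ≡.refl))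
      (trans (+-zeroˡ (q 2F 2F ≡.refl)) (trans (+-zeroˡ (q 2F 3F ≡.refl))
        (+-zeroʳ (sum-zero λ j → q 2F (5+ j) ≡.refl)))))

  total-sparse : ∀ m {A W} → Sparse m A W → W 0F 0F ≈ 0# → (∀ i → W (suc i) 0F ≈ 0#) →
    total W ≈ W 0F 1F + (W 0F 2F + levelSum _+_ m W)
  total-sparse m {A} {W} s W₀₀ Wᵢ₀ = begin
    (W 0F 0F + (a + (b + R))) + sum (λ i → W (suc i) 0F + sum λ j → W (suc i) (suc j))
      ≈⟨ +-cong (+-zeroˡ W₀₀) (sum-cong-≋ λ i → sum-tail (W (suc i)) (Wᵢ₀ i)) ⟩
    (a + (b + R)) + T
      ≈⟨ solve 4 (λ a b r t → (a ⊕ (b ⊕ r)) ⊕ t ⊜ a ⊕ (b ⊕ (r ⊕ t))) refl a b R T ⟩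
    a + (b + (R + T))
      ≈⟨ +-congˡ (+-congˡ (total-rest m s)) ⟩
    a + (b + levelSum _+_ m W) ∎
    where
    a = W 0F 1F
    b = W 0F 2F
    R = sum λ j → W 0F (3+ j)
    T = total λ i j → W (suc i) (suc j)

  -- Uniqueness from the tight cuts

  module _ (halve : ∀ x → x + x ≈ 0# → x ≈ 0#) where

    -- Replaces subtraction: `e` and `f` are sums of known zeros, and `x` is what is counted twice
    -- between them.
    halving : ∀ {x e f} → x + x + e ≈ f → e ≈ 0# → f ≈ 0# → x ≈ 0#
    halving {x} eq e≈0 f≈0 = halve x (trans (sym (+-zeroʳ e≈0)) (trans eq f≈0))

    cancelˡ : ∀ {x y} → x + y ≈ 0# → x ≈ 0# → y ≈ 0#
    cancelˡ xy x≈0 = trans (sym (+-zeroˡ x≈0)) xy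

    sum-zeros : ∀ {x y} → x ≈ 0# → y ≈ 0# → x + y ≈ 0#
    sum-zeros x≈0 y≈0 = trans (+-zeroˡ x≈0) y≈0

    -- The equations come from the contracted graph (two), from the cuts c, u, v, {u , v} and from
    -- the complements of {s} and {s , c}.
    first-level : ∀ {d₁ d₂ cv uv uc cu vu sc} →
      sc + uc ≈ 0# → cu + vu ≈ 0# →
      d₁ + (cv + cu) ≈ 0# → d₂ + (uv + uc) ≈ 0# → cv + (uv + vu) ≈ 0# →
      d₂ + (cv + (uc + vu)) ≈ 0# → d₁ + (d₂ + sc) ≈ 0# → d₂ + (cv + (cu + sc)) ≈ 0# →
      (d₁ ≈ 0# × d₂ ≈ 0#) × (cv ≈ 0# × uv ≈ 0# × uc ≈ 0# × cu ≈ 0# × vu ≈ 0# × sc ≈ 0#)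
    first-level {d₁} {d₂} {cv} {uv} {uc} {cu} {vu} {sc} sc+uc cu+vu C U V UV all but =
      (d₁≈0 , d₂≈0) , cv≈0 , uv≈0 , uc≈0 , cu≈0 , cancelˡ cu+vu cu≈0 , sc≈0
      where
      uv≈0 : uv ≈ 0#
      -- The degrees of `u` and `v` together exceed the cut of `{u , v}` by twice the edge `u v`.
      uv≈0 = halving (solve 5 (λ d uv uc cv vu →
        (uv ⊕ uv) ⊕ (d ⊕ (cv ⊕ (uc ⊕ vu))) ⊜ (d ⊕ (uv ⊕ uc)) ⊕ (cv ⊕ (uv ⊕ vu)))
        refl d₂ uv uc cv vu) UV (sum-zeros U V)
      d₂+sc : d₂ + sc ≈ 0#
      -- The cuts of `{s}` and `{s , c}` together exceed the degree of `c` by twice the edges at `s`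
      -- other than `s c`.
      d₂+sc = halving (solve 5 (λ d e cv cu sc →
        ((e ⊕ sc) ⊕ (e ⊕ sc)) ⊕ (d ⊕ (cv ⊕ cu)) ⊜ (e ⊕ (cv ⊕ (cu ⊕ sc))) ⊕ (d ⊕ (e ⊕ sc)))
        refl d₁ d₂ cv cu sc) C (sum-zeros but all)
      d₂+uc : d₂ + uc ≈ 0#
      d₂+uc = trans (+-congˡ (sym (+-zeroˡ uv≈0))) U
      d₂≈0 : d₂ ≈ 0#
      -- `d₂` is now paired with `sc` and with `uc`; the contracted graph supplies the sum of these
      -- two, which separates all three.
      d₂≈0 = halving (solve 3 (λ e sc uc →
        (e ⊕ e) ⊕ (sc ⊕ uc) ⊜ (e ⊕ sc) ⊕ (e ⊕ uc)) refl d₂ sc uc) sc+uc (sum-zeros d₂+sc d₂+uc)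
      sc≈0 : sc ≈ 0#
      sc≈0 = cancelˡ d₂+sc d₂≈0
      uc≈0 : uc ≈ 0#
      uc≈0 = cancelˡ d₂+uc d₂≈0
      d₁≈0 : d₁ ≈ 0#
      d₁≈0 = trans (sym (+-zeroʳ d₂+sc)) all
      cv+cu : cv + cu ≈ 0#
      cv+cu = cancelˡ C d₁≈0
      cv≈0 : cv ≈ 0#
      cv≈0 = halving (solve 3 (λ cv cu vu →
        (cv ⊕ cv) ⊕ (cu ⊕ vu) ⊜ (cv ⊕ cu) ⊕ (cv ⊕ vu)) refl cv cu vu) cu+vu
        (sum-zeros cv+cu (trans (+-congˡ (sym (+-zeroˡ uv≈0))) V))
      cu≈0 : cu ≈ 0#
      cu≈0 = cancelˡ cv+cu cv≈0

    -- Cuts that avoid `c_0`, `u_0` and `v_0` are cuts of the contracted graph, whose root edges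
    -- have the values `sc + uc` and `cu + vu`. By induction these two sums and all later entries
    -- vanish; with the six cuts of the first level this gives eight equations for eight unknowns.
    rigid : ∀ m A {d₁ d₂ W} → Sparse m A W →
      (∀ {ζ} → Tight m ζ → cost m ζ d₁ d₂ W ≈ 0#) → (d₁ ≈ 0# × d₂ ≈ 0#) × W ≋ O
    rigid zero A {d₁} {d₂} {W} (p , q) tight = (d₁≈0 , d₂≈0) , (λ ()) , λ
      { 0F 0F → q 0F 0F ≡.refl
      ; 0F 1F → cancelˡ d₁+e d₁≈0
      ; 1F 0F → q 1F 0F ≡.refl
      ; 1F 1F → q 1F 1F ≡.refl
      }
      where
      e = W 1F 2F
      d₁+e : d₁ + e ≈ 0#
      d₁+e = trans (+-congˡ (sym (+-identityˡ e))) (tight c-tight)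
      d₂+e : d₂ + e ≈ 0#
      d₂+e = trans (sym (+-identityˡ _)) (tight u-tight)
      d₁+d₂ : d₁ + d₂ ≈ 0#
      d₁+d₂ = trans (+-congˡ (sym (+-identityʳ d₂))) (tight all-tight)
      d₁≈0 : d₁ ≈ 0#
      -- In the triangle each tight cut is the sum of two of the three values.
      d₁≈0 = halving (solve 3 (λ d f e → (d ⊕ d) ⊕ (f ⊕ e) ⊜ (d ⊕ e) ⊕ (d ⊕ f)) refl d₁ d₂ e)
        d₂+e (sum-zeros d₁+e d₁+d₂)
      d₂≈0 : d₂ ≈ 0#
      d₂≈0 = cancelˡ d₁+d₂ d₁≈0
    rigid (suc m) A {d₁} {d₂} {W} sp@(p , q) tight =
      let (sc+uc , cu+vu) , W′≋O@(p′ , q′) = contracted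
          (d₁≈0 , d₂≈0) , cv≈0 , uv≈0 , uc≈0 , cu≈0 , vu≈0 , sc≈0 =
            first-level sc+uc cu+vu (C W′≋O) (U W′≋O) (V W′≋O) (UV W′≋O) (all W′≋O) (but W′≋O)
      in (d₁≈0 , d₂≈0) ,
         (λ { 0F → p 0F ≡.refl
            ; 1F → sc≈0
            ; 2F → p 2F ≡.refl
            ; (3+ j) → p′ j
            }) ,
         λ { 0F 0F → q 0F 0F ≡.refl
           ; 0F 1F → q 0F 1F ≡.refl
           ; 0F 2F → cv≈0
           ; 0F 3F → q 0F 3F ≡.refl
           ; 0F 4F → cu≈0
           ; 0F (5+ j) → q 0F (5+ j) ≡.refl
           ; 1F 0F → q 1F 0F ≡.refl
           ; 1F 1F → q 1F 1F ≡.refl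
           ; 1F 2F → uv≈0
           ; 1F 3F → uc≈0
           ; 1F 4F → q 1F 4F ≡.refl
           ; 1F (5+ j) → q 1F (5+ j) ≡.refl
           ; 2F 0F → q 2F 0F ≡.refl
           ; 2F 1F → q 2F 1F ≡.refl
           ; 2F 2F → q 2F 2F ≡.refl
           ; 2F 3F → q 2F 3F ≡.refl
           ; 2F 4F → vu≈0
           ; 2F (5+ j) → q 2F (5+ j) ≡.refl
           ; (3+ i) 0F → q (3+ i) 0F ≡.refl
           ; (3+ i) 1F → q (3+ i) 1F ≡.refl
           ; (3+ i) 2F → q (3+ i) 2F ≡.refl
           ; (3+ i) (3+ j) → q′ i j
           }
      where
      cv = W 1F 3F
      uv = W 2F 3F
      uc = W 2F 4F
      cu = W 1F 5F
      vu = W 3F 5F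
      sc = W 0F 4F
      W′ = expanded W

      contracted : (sc + uc ≈ 0# × cu + vu ≈ 0#) × W′ ≋ O
      contracted = rigid m (A ℕ.+ A) (expanded-sparse m {A} {W} sp) λ {ζ} t → begin
        cut false (ζ 0F) (sc + uc) + (cut false (ζ 1F) (cu + vu) +
          levelSum _+_ m (cuts (rooted ζ) W′))
          ≈⟨ +-cong (cut-+ false (ζ 0F) sc uc) (+-cong (cut-+ false (ζ 1F) cu vu)
               (levelSum-cong m ((λ j → refl) , λ i j → refl))) ⟩
        (cut false (ζ 0F) sc + cut false (ζ 0F) uc) +
          ((cut false (ζ 1F) cu + cut false (ζ 1F) vu) + _)
          ≈⟨ solve 5 (λ sc uc cu vu t → (sc ⊕ uc) ⊕ ((cu ⊕ vu) ⊕ t) ⊜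
               id ⊕ (id ⊕ (id ⊕ (id ⊕ (uc ⊕ (cu ⊕ (vu ⊕ (sc ⊕ t))))))))
               refl (cut false (ζ 0F) sc) (cut false (ζ 0F) uc)
                 (cut false (ζ 1F) cu) (cut false (ζ 1F) vu) _ ⟩
        cost (suc m) (false ∷ false ∷ false ∷ ζ) d₁ d₂ W
          ≈⟨ tight (later-tight t) ⟩
        0# ∎

      equation : W′ ≋ O → ∀ {ζ} → Tight (suc m) ζ →
        cut false (ζ 0F) d₁ + (cut false (ζ 1F) d₂ +
          (cut (ζ 0F) (ζ 2F) cv + (cut (ζ 1F) (ζ 2F) uv + (cut (ζ 1F) (ζ 3F) uc +
            (cut (ζ 0F) (ζ 4F) cu + (cut (ζ 2F) (ζ 4F) vu + (cut false (ζ 3F) sc + 0#))))))) ≈ 0#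
      equation W′≋O {ζ} t = trans
        (+-congˡ (+-congˡ (+-congˡ (+-congˡ (+-congˡ (+-congˡ (+-congˡ (+-congˡ (sym
          (levelSum-zero m (cuts-zero (λ i → rooted ζ (expand i)) W′≋O)))))))))))
        (tight t)

      C : W′ ≋ O → d₁ + (cv + cu) ≈ 0#
      C e = trans (solve 3 (λ d a b → d ⊕ (a ⊕ b) ⊜
        d ⊕ (id ⊕ (a ⊕ (id ⊕ (id ⊕ (b ⊕ (id ⊕ (id ⊕ id)))))))) refl d₁ cv cu)
        (equation e c-tight)
      U : W′ ≋ O → d₂ + (uv + uc) ≈ 0#
      U e = trans (solve 3 (λ d a b → d ⊕ (a ⊕ b) ⊜
        id ⊕ (d ⊕ (id ⊕ (a ⊕ (b ⊕ (id ⊕ (id ⊕ (id ⊕ id)))))))) refl d₂ uv uc)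
        (equation e u-tight)
      V : W′ ≋ O → cv + (uv + vu) ≈ 0#
      V e = trans (solve 3 (λ d a b → d ⊕ (a ⊕ b) ⊜
        id ⊕ (id ⊕ (d ⊕ (a ⊕ (id ⊕ (id ⊕ (b ⊕ (id ⊕ id)))))))) refl cv uv vu)
        (equation e v-tight)
      UV : W′ ≋ O → d₂ + (cv + (uc + vu)) ≈ 0#
      UV e = trans (solve 4 (λ d a b f → d ⊕ (a ⊕ (b ⊕ f)) ⊜
        id ⊕ (d ⊕ (a ⊕ (id ⊕ (b ⊕ (id ⊕ (f ⊕ (id ⊕ id)))))))) refl d₂ cv uc vu)
        (equation e uv-tight)
      all : W′ ≋ O → d₁ + (d₂ + sc) ≈ 0#
      all e = trans (solve 3 (λ d a b → d ⊕ (a ⊕ b) ⊜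
        d ⊕ (a ⊕ (id ⊕ (id ⊕ (id ⊕ (id ⊕ (id ⊕ (b ⊕ id)))))))) refl d₁ d₂ sc)
        (equation e all-tight)
      but : W′ ≋ O → d₂ + (cv + (cu + sc)) ≈ 0#
      but e = trans (solve 4 (λ d a b f → d ⊕ (a ⊕ (b ⊕ f)) ⊜
        id ⊕ (d ⊕ (a ⊕ (id ⊕ (id ⊕ (b ⊕ (id ⊕ (f ⊕ id)))))))) refl d₂ cv cu sc)
        (equation e but-c-tight)

-- Linearity of sums, and transfer along additive maps

module Linear {c ℓ} (R : CommutativeRing c ℓ) where
  open CommutativeRing R hiding (zero)
  open Sum +-commutativeMonoid using () renaming (sum to ∑)
  open Cuts +-commutativeMonoid using (Matrix; total)
  open import Relation.Binary.Reasoning.Setoid setoid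
  open import Algebra.Properties.CommutativeSemigroup +-commutativeSemigroup using (interchange)
  open import Algebra.Properties.Ring ring using (-1*x≈-x)

  sum-linear : ∀ {n} a b (f g h : Vector Carrier n) →
    (∀ i → f i ≈ a * g i + b * h i) → ∑ f ≈ a * ∑ g + b * ∑ h
  sum-linear {zero}  a b f g h eq = sym (trans (+-cong (zeroʳ a) (zeroʳ b)) (+-identityˡ 0#))
  sum-linear {suc n} a b f g h eq = begin
    f zero + ∑ (λ i → f (suc i))
      ≈⟨ +-cong (eq zero)
           (sum-linear a b (λ i → f (suc i)) (λ i → g (suc i)) (λ i → h (suc i)) λ i → eq (suc i)) ⟩
    (a * g zero + b * h zero) + (a * ∑ (λ i → g (suc i)) + b * ∑ (λ i → h (suc i)))
      ≈⟨ interchange _ _ _ _ ⟩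
    (a * g zero + a * ∑ (λ i → g (suc i))) + (b * h zero + b * ∑ (λ i → h (suc i)))
      ≈⟨ +-cong (distribˡ a _ _) (distribˡ b _ _) ⟨
    a * ∑ g + b * ∑ h ∎

  total-linear : ∀ {n} a b (U V W : Matrix n) →
    (∀ i j → W i j ≈ a * U i j + b * V i j) → total W ≈ a * total U + b * total V
  total-linear a b U V W eq = sum-linear a b _ _ _ λ i →
    sum-linear a b (W i) (U i) (V i) (eq i)

  zero-linear : ∀ a b {x y} → x ≈ 0# → y ≈ 0# → a * x + b * y ≈ 0#
  zero-linear a b x≈0 y≈0 = trans (+-cong (trans (*-congˡ x≈0) (zeroʳ a))
    (trans (*-congˡ y≈0) (zeroʳ b))) (+-identityˡ 0#)

  linear-zero : ∀ a b → 0# ≈ a * 0# + b * 0#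
  linear-zero a b = sym (zero-linear a b refl refl)

  -- The difference is written as a linear combination so that `total-linear` covers it.
  difference : ∀ x y → 1# * x + (- 1#) * y ≈ 0# → x ≈ y
  difference x y eq = begin
    x                                    ≈⟨ +-identityʳ x ⟨
    x + 0#                               ≈⟨ +-congˡ (-‿inverseˡ y) ⟨
    x + (- y + y)                        ≈⟨ +-assoc x (- y) y ⟨
    (x + - y) + y                        ≈⟨ +-congʳ (+-cong (*-identityˡ x) (-1*x≈-x y)) ⟨
    (1# * x + (- 1#) * y) + y            ≈⟨ +-congʳ eq ⟩
    0# + y                               ≈⟨ +-identityˡ y ⟩
    y                                    ∎

  equal-difference : ∀ {x y} → x ≈ y → 1# * x + (- 1#) * y ≈ 0#
  equal-difference {x} {y} x≈y = trans (+-cong (trans (*-identityˡ x) x≈y) (-1*x≈-x y)) (-‿inverseʳ y)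

module Homomorphism {c ℓ c′ ℓ′} (M : CommutativeMonoid c ℓ) (N : CommutativeMonoid c′ ℓ′) where
  private
    module M = CommutativeMonoid M
    module N = CommutativeMonoid N
    module CM = Cuts M
    module CN = Cuts N

  module _ (f : M.Carrier → N.Carrier) (f-∙ : ∀ x y → f (x M.∙ y) N.≈ f x N.∙ f y)
           (f-ε : f M.ε N.≈ N.ε) where

    cut-homo : ∀ a b x → CN.cut a b (f x) N.≈ f (CM.cut a b x)
    cut-homo a b x with a xor b
    ... | true  = N.refl
    ... | false = N.sym f-ε

    levelSum-homo : ∀ m (W : CM.Matrix (order m)) →
      levelSum N._∙_ m (λ i j → f (W i j)) N.≈ f (levelSum M._∙_ m W)
    levelSum-homo zero    W = N.refl
    levelSum-homo (suc m) W = step (step (step (step (step (step (levelSum-homo m (CM.expanded W)))))))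
      where
      step : ∀ {x y y′} → y′ N.≈ f y → (f x N.∙ y′) N.≈ f (x M.∙ y)
      step eq = N.trans (N.∙-congˡ eq) (N.sym (f-∙ _ _))

    -- Through this, cut values of the real point are computed in the natural numbers.
    cost-homo : ∀ m ζ d₁ d₂ (W : CM.Matrix (order m)) →
      CN.cost m ζ (f d₁) (f d₂) (λ i j → f (W i j)) N.≈ f (CM.cost m ζ d₁ d₂ W)
    cost-homo m ζ d₁ d₂ W = N.trans (N.∙-cong (cut-homo false (ζ 0F) d₁)
      (N.trans (N.∙-cong (cut-homo false (ζ 1F) d₂)
        (N.trans (CN.levelSum-cong m
            ((λ j → cut-homo false (ζ (suc (suc j))) _) CN., λ i j → cut-homo (ζ i) (ζ j) _))
          (levelSum-homo m (CM.cuts (rooted ζ) W)))) (N.sym (f-∙ _ _)))) (N.sym (f-∙ _ _))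

open ≡ using (refl; cong; cong₂; sym; trans; subst; subst₂)

-- The cut inequalities and the tight cuts

module Costs where
  open import Data.Nat.Base using (_+_; _*_; _∸_; _≤_)

  ℕ-sums : CommutativeMonoid 0ℓ 0ℓ
  ℕ-sums = ℕ.+-0-commutativeMonoid

  module ℕC = Cuts ℕ-sums

  -- A pair (p , q) stands for p A + q r, where the unit is 2A + r.
  module Coeff = Cuts (commutativeMonoid ℕ-sums ℕ-sums)

  Coefficients : Set
  Coefficients = ℕ × ℕ

  module Evaluate (A r : ℕ) where
    open CommutativeMonoid (commutativeMonoid ℕ-sums ℕ-sums) using (_∙_)

    ev : Coefficients → ℕ
    ev (p , q) = p * A + q * r

    ev-∙ : ∀ k l → ev (k ∙ l) ≡ ev k + ev l
    ev-∙ (p , q) (p′ , q′) = lemma p q p′ q′ A r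
      where
      lemma : ∀ p q p′ q′ A r → (p + p′) * A + (q + q′) * r ≡ (p * A + q * r) + (p′ * A + q′ * r)
      lemma = solve-∀

    ev-cut : ∀ a b k → ev (Coeff.cut a b k) ≡ ℕC.cut a b (ev k)
    ev-cut a b k with a xor b
    ... | true  = refl
    ... | false = refl

    ev-cut-∙ : ∀ a b k {l s} → ev l ≡ s → ev (Coeff.cut a b k ∙ l) ≡ ℕC.cut a b (ev k) + s
    ev-cut-∙ a b k {l} eq = trans (ev-∙ (Coeff.cut a b k) l) (cong₂ _+_ (ev-cut a b k) eq)

    ev-level : ∀ c u v c′ u′ N K B t →
      ev (Coeff.level c u v c′ u′ N K B t) ≡ ℕC.level c u v c′ u′ (ev N) (ev K) (ev B) (ev t)
    ev-level c u v c′ u′ N K B t = ev-cut-∙ c v K (ev-cut-∙ u v N (ev-cut-∙ u c′ K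
      (ev-cut-∙ c u′ B (ev-cut-∙ v u′ B (ev-cut-∙ false c′ B refl)))))

    ev-mono : ∀ {k l} → proj₁ k ≤ proj₁ l × proj₂ k ≤ proj₂ l → ev k ≤ ev l
    ev-mono (p≤ , q≤) = ℕ.+-mono-≤ (ℕ.*-monoˡ-≤ A p≤) (ℕ.*-monoˡ-≤ r q≤)

  -- Coefficientwise order is decidable, and it implies the inequality of values for all `A` and `r`
  -- at once.
  _≼_ : Coefficients → Coefficients → Set
  k ≼ l = proj₁ k ≤ proj₁ l × proj₂ k ≤ proj₂ l

  _≼?_ : ∀ k l → Dec (k ≼ l)
  k ≼? l = (proj₁ k ℕ.≤? proj₁ l) ×-dec (proj₂ k ℕ.≤? proj₂ l)

  ∀Bool? : ∀ {P : Bool → Set} → (∀ b → Dec (P b)) → Dec (∀ b → P b)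
  ∀Bool? P? = map′ (λ { (f , t) false → f ; (f , t) true → t }) (λ p → p false , p true)
    (P? false ×-dec P? true)

  -- The least value of cutLevels for given membership of c_0 and u_0.
  potential : Bool → Bool → ℕ → ℕ → ℕ
  potential false false N A = 0
  potential true  false N A = N
  potential false true  N A = N + (N ∸ A)
  potential true  true  N A = N ∸ A

  -- The potential at a level, and at the next one, where A is doubled.
  before after : Bool → Bool → Coefficients
  before false false = 0 , 0
  before true  false = 2 , 1
  before false true  = 3 , 2
  before true  true  = 1 , 1
  after false false = 0 , 0
  after true  false = 2 , 1
  after false true  = 2 , 2
  after true  true  = 0 , 1

  step : Bool → Bool → Bool → Bool → Bool → Coefficients
  step c u v c′ u′ = Coeff.level c u v c′ u′ (2 , 1) (1 , 1) (1 , 0) (after c′ u′)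

  -- The whole inductive step of the dynamic program: a check of 32 cases, independent of the level
  -- and of `A`.
  step-bound : ∀ c u v c′ u′ → before c u ≼ step c u v c′ u′
  step-bound = from-yes (∀Bool? λ c → ∀Bool? λ u → ∀Bool? λ v → ∀Bool? λ c′ → ∀Bool? λ u′ →
    before c u ≼? step c u v c′ u′)

  -- The pair `(4 , 2)` is twice the unit `(2 , 1)`: if `v_0` is separated from `s`, `c_0` and
  -- `u_0`, the levels alone pay for the cut.
  v-bound : ∀ c′ u′ → (4 , 2) ≼ step false false true c′ u′
  v-bound = from-yes (∀Bool? λ c′ → ∀Bool? λ u′ → (4 , 2) ≼? step false false true c′ u′)

  A≤unit : ∀ m A → A ≤ unit m A
  A≤unit zero    A = ℕ.≤-refl
  A≤unit (suc m) A = ℕ.≤-trans (ℕ.m≤m+n A A) (A≤unit m (A + A))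

  cutLevels : ∀ m → ℕ → Vector Bool (2 + m * 3) → ℕ
  cutLevels m A ζ = levelSum _+_ m (ℕC.cuts (rooted ζ) (weight m A))

  cutCost : ∀ m → ℕ → Vector Bool (2 + m * 3) → ℕ
  cutCost m A ζ = ℕC.cost m ζ (unit m A) A (weight m A)

  later : ∀ {n} → Vector Bool (3 + n) → Vector Bool n
  later ζ i = ζ (3+ i)

  module LevelBounds (m A : ℕ) where
    -- Exact, because `unit (suc m) A` is `unit m (A + A)` and hence at least `A + A`.
    r : ℕ
    r = unit (suc m) A ∸ (A + A)

    open Evaluate A r public

    N≡ : unit (suc m) A ≡ (A + A) + r
    N≡ = sym (ℕ.m+[n∸m]≡n (A≤unit m (A + A)))

    ev-A : A ≡ ev (1 , 0)
    ev-A = lemma A r where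
      lemma : ∀ A r → A ≡ 1 * A + 0 * r
      lemma = solve-∀

    ev-N : unit (suc m) A ≡ ev (2 , 1)
    ev-N = trans N≡ (lemma A r) where
      lemma : ∀ A r → (A + A) + r ≡ 2 * A + 1 * r
      lemma = solve-∀

    ev-N∸A : unit (suc m) A ∸ A ≡ ev (1 , 1)
    ev-N∸A = trans (cong (_∸ A) (trans N≡ (ℕ.+-assoc A A r)))
      (trans (ℕ.m+n∸m≡n A (A + r)) (lemma A r)) where
      lemma : ∀ A r → A + r ≡ 1 * A + 1 * r
      lemma = solve-∀

    ev-r : r ≡ ev (0 , 1)
    ev-r = lemma A r where
      lemma : ∀ A r → r ≡ 0 * A + 1 * r
      lemma = solve-∀

    potential-before : ∀ c u → potential c u (unit (suc m) A) A ≡ ev (before c u)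
    potential-before false false = refl
    potential-before true  false = ev-N
    potential-before false true  = trans (cong₂ _+_ ev-N ev-N∸A) (sym (ev-∙ (2 , 1) (1 , 1)))
    potential-before true  true  = ev-N∸A

    potential-after : ∀ c u → potential c u (unit m (A + A)) (A + A) ≡ ev (after c u)
    potential-after false false = refl
    potential-after true  false = ev-N
    potential-after false true  = trans (cong₂ _+_ ev-N ev-r) (sym (ev-∙ (2 , 1) (0 , 1)))
    potential-after true  true  = ev-r

    cutLevels-level : ∀ ζ → cutLevels (suc m) A ζ ≡
      ℕC.level (ζ 0F) (ζ 1F) (ζ 2F) (ζ 3F) (ζ 4F) (ev (2 , 1)) (ev (1 , 1)) (ev (1 , 0))
        (cutLevels m (A + A) (later ζ))
    cutLevels-level ζ = level-cong ev-N ev-N∸A ev-A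
      -- `rooted ζ` after `expand` agrees with `rooted (later ζ)` constructor by constructor only,
      -- so a congruence stands where `refl` would fail.
      (ℕC.levelSum-cong m ((λ _ → refl) ℕC., λ _ _ → refl))
      where
      level-cong : ∀ {N K B t N′ K′ B′ t′} → N ≡ N′ → K ≡ K′ → B ≡ B′ → t ≡ t′ →
        ℕC.level (ζ 0F) (ζ 1F) (ζ 2F) (ζ 3F) (ζ 4F) N K B t ≡
        ℕC.level (ζ 0F) (ζ 1F) (ζ 2F) (ζ 3F) (ζ 4F) N′ K′ B′ t′
      level-cong refl refl refl refl = refl

    level-mono : ∀ c u v c′ u′ {N K B t t′} → t ≤ t′ →
      ℕC.level c u v c′ u′ N K B t ≤ ℕC.level c u v c′ u′ N K B t′
    level-mono c u v c′ u′ {N} {K} {B} t≤ =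
      ℕ.+-monoʳ-≤ (ℕC.cut c v K) (ℕ.+-monoʳ-≤ (ℕC.cut u v N) (ℕ.+-monoʳ-≤ (ℕC.cut u c′ K)
      (ℕ.+-monoʳ-≤ (ℕC.cut c u′ B) (ℕ.+-monoʳ-≤ (ℕC.cut v u′ B)
      (ℕ.+-monoʳ-≤ (ℕC.cut false c′ B) t≤)))))

    level-bound : ∀ {k} ζ → k ≼ step (ζ 0F) (ζ 1F) (ζ 2F) (ζ 3F) (ζ 4F) →
      potential (ζ 3F) (ζ 4F) (unit m (A + A)) (A + A) ≤ cutLevels m (A + A) (later ζ) →
      ev k ≤ cutLevels (suc m) A ζ
    level-bound {k} ζ k≼ ih = begin
      ev k
        ≤⟨ ev-mono k≼ ⟩
      ev (step (ζ 0F) (ζ 1F) (ζ 2F) (ζ 3F) (ζ 4F))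
        ≡⟨ ev-level (ζ 0F) (ζ 1F) (ζ 2F) (ζ 3F) (ζ 4F) (2 , 1) (1 , 1) (1 , 0) _ ⟩
      ℕC.level (ζ 0F) (ζ 1F) (ζ 2F) (ζ 3F) (ζ 4F) _ _ _ (ev (after (ζ 3F) (ζ 4F)))
        ≡⟨ cong (ℕC.level (ζ 0F) (ζ 1F) (ζ 2F) (ζ 3F) (ζ 4F) _ _ _)
             (potential-after (ζ 3F) (ζ 4F)) ⟨
      ℕC.level (ζ 0F) (ζ 1F) (ζ 2F) (ζ 3F) (ζ 4F) _ _ _
        (potential (ζ 3F) (ζ 4F) (unit m (A + A)) (A + A))
        ≤⟨ level-mono (ζ 0F) (ζ 1F) (ζ 2F) (ζ 3F) (ζ 4F) ih ⟩
      ℕC.level (ζ 0F) (ζ 1F) (ζ 2F) (ζ 3F) (ζ 4F) _ _ _ (cutLevels m (A + A) (later ζ))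
        ≡⟨ cutLevels-level ζ ⟨
      cutLevels (suc m) A ζ ∎
      where open ℕ.≤-Reasoning

  potential-bound : ∀ m A ζ → potential (ζ 0F) (ζ 1F) (unit m A) A ≤ cutLevels m A ζ
  potential-bound zero A ζ with ζ 0F | ζ 1F
  ... | false | false = ℕ.≤-refl
  ... | true  | false = ℕ.≤-refl
  ... | false | true  = ℕ.≤-reflexive (trans (cong (A ℕ.+_) (ℕ.n∸n≡0 A)) (ℕ.+-identityʳ A))
  ... | true  | true  = ℕ.≤-reflexive (ℕ.n∸n≡0 A)
  potential-bound (suc m) A ζ = begin
    potential (ζ 0F) (ζ 1F) (unit (suc m) A) A
      ≡⟨ potential-before (ζ 0F) (ζ 1F) ⟩
    ev (before (ζ 0F) (ζ 1F))
      ≤⟨ level-bound ζ (step-bound (ζ 0F) (ζ 1F) (ζ 2F) (ζ 3F) (ζ 4F))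
           (potential-bound m (A + A) (later ζ)) ⟩
    cutLevels (suc m) A ζ ∎
    where
    open LevelBounds m A
    open ℕ.≤-Reasoning

  -- The potential is exactly what the cut root edges leave missing from two units.
  start-bound : ∀ c u {N A} → A ≤ N → c ∨ u ≡ true →
    N + N ≡ ℕC.cut false c N + (ℕC.cut false u A + potential c u N A)
  start-bound true  false A≤N _ = refl
  start-bound true  true {N} A≤N _ = cong (N ℕ.+_) (sym (ℕ.m+[n∸m]≡n A≤N))
  start-bound false true {N} {A} A≤N _ = begin
    N + N             ≡⟨ cong (N ℕ.+_) (ℕ.m+[n∸m]≡n A≤N) ⟨
    N + (A + (N ∸ A)) ≡⟨ lemma N A (N ∸ A) ⟩
    A + (N + (N ∸ A)) ∎
    where
    open ≡.≡-Reasoning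
    lemma : ∀ N A K → N + (A + K) ≡ A + (N + K)
    lemma = solve-∀

  contract : ∀ m A ζ → ζ 0F ≡ false → ζ 1F ≡ false → ζ 2F ≡ false →
    cutCost (suc m) A ζ ≡ cutCost m (A + A) (later ζ)
  contract m A ζ c u v = trans (cong₂ _+_ (cong (λ b → ℕC.cut false b N) c)
    (cong₂ _+_ (cong (λ b → ℕC.cut false b A) u) expand-level)) (regroup (ζ 3F) (ζ 4F))
    where
    N = unit (suc m) A
    T = cutLevels m (A + A) (later ζ)
    lvl : Bool → Bool → Bool → ℕ
    lvl c u v = ℕC.level c u v (ζ 3F) (ζ 4F) N (N ∸ A) A T
    expand-level : cutLevels (suc m) A ζ ≡ lvl false false false
    expand-level = trans (cong (ℕC.level (ζ 0F) (ζ 1F) (ζ 2F) (ζ 3F) (ζ 4F) N (N ∸ A) A)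
      (ℕC.levelSum-cong m ((λ _ → refl) ℕC., λ _ _ → refl)))
      (trans (cong (λ b → lvl b (ζ 1F) (ζ 2F)) c)
      (trans (cong (λ b → lvl false b (ζ 2F)) u) (cong (lvl false false) v)))
    regroup : ∀ c′ u′ → ℕC.level false false false c′ u′ N (N ∸ A) A T ≡
      ℕC.cut false c′ N + (ℕC.cut false u′ (A + A) + T)
    regroup false false = refl
    regroup false true  = sym (ℕ.+-assoc A A T)
    regroup true  false = trans (sym (ℕ.+-assoc (N ∸ A) A T))
      (cong (_+ T) (ℕ.m∸n+n≡m (A≤unit (suc m) A)))
    regroup true  true  = begin
      (N ∸ A) + (A + (A + (A + T))) ≡⟨ lemma (N ∸ A) A T ⟩
      ((N ∸ A) + A) + ((A + A) + T) ≡⟨ cong (_+ ((A + A) + T)) (ℕ.m∸n+n≡m (A≤unit (suc m) A)) ⟩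
      N + ((A + A) + T)             ∎
      where
      open ≡.≡-Reasoning
      lemma : ∀ K A T → K + (A + (A + (A + T))) ≡ (K + A) + ((A + A) + T)
      lemma = solve-∀

  start-case : ∀ m A ζ → ζ 0F ∨ ζ 1F ≡ true → unit m A + unit m A ≤ cutCost m A ζ
  start-case m A ζ cu = begin
    unit m A + unit m A
      ≡⟨ start-bound (ζ 0F) (ζ 1F) (A≤unit m A) cu ⟩
    ℕC.cut false (ζ 0F) (unit m A) + (ℕC.cut false (ζ 1F) A + potential (ζ 0F) (ζ 1F) (unit m A) A)
      ≤⟨ ℕ.+-monoʳ-≤ (ℕC.cut false (ζ 0F) (unit m A))
           (ℕ.+-monoʳ-≤ (ℕC.cut false (ζ 1F) A) (potential-bound m A ζ)) ⟩
    cutCost m A ζ ∎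
    where open ℕ.≤-Reasoning

  v-case : ∀ m A ζ → ζ 0F ≡ false → ζ 1F ≡ false → ζ 2F ≡ true →
    unit (suc m) A + unit (suc m) A ≤ cutCost (suc m) A ζ
  v-case m A ζ c u v = begin
    N + N                   ≡⟨ trans (cong₂ _+_ ev-N ev-N) (sym (ev-∙ (2 , 1) (2 , 1))) ⟩
    ev (4 , 2)              ≤⟨ level-bound ζ bound (potential-bound m (A + A) (later ζ)) ⟩
    cutLevels (suc m) A ζ     ≤⟨ ℕ.m≤n+m _ (ℕC.cut false (ζ 1F) A) ⟩
    ℕC.cut false (ζ 1F) A + cutLevels (suc m) A ζ ≤⟨ ℕ.m≤n+m _ (ℕC.cut false (ζ 0F) N) ⟩
    cutCost (suc m) A ζ     ∎
    where
    open LevelBounds m A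
    open ℕ.≤-Reasoning
    N = unit (suc m) A
    bound : (4 , 2) ≼ step (ζ 0F) (ζ 1F) (ζ 2F) (ζ 3F) (ζ 4F)
    bound rewrite c | u | v = v-bound (ζ 3F) (ζ 4F)

  -- The potential settles cuts that contain `c_0` or `u_0`, and `v-case` those that contain `v_0`
  -- alone of the three. Otherwise the member of the cut lies in the contracted graph, so that cut
  -- is again nonempty.
  cost-bound : ∀ m A ζ → ∃ (λ i → ζ i ≡ true) → unit m A + unit m A ≤ cutCost m A ζ
  cost-bound m A ζ (0F , p) = start-case m A ζ (cong (_∨ ζ 1F) p)
  cost-bound m A ζ (1F , p) = start-case m A ζ (trans (cong (ζ 0F ∨_) p) (∨-zeroʳ (ζ 0F)))
  cost-bound (suc m) A ζ (suc (suc i) , p) = cases (ζ 0F) (ζ 1F) (ζ 2F) refl refl refl i p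
    where
    cases : ∀ c u v → ζ 0F ≡ c → ζ 1F ≡ u → ζ 2F ≡ v → ∀ i → ζ (suc (suc i)) ≡ true →
      unit (suc m) A + unit (suc m) A ≤ cutCost (suc m) A ζ
    cases true  _     _     c u v i       p = start-case (suc m) A ζ (cong (_∨ ζ 1F) c)
    cases false true  _     c u v i       p = start-case (suc m) A ζ (cong₂ _∨_ c u)
    cases false false true  c u v i       p = v-case m A ζ c u v
    cases false false false c u v zero    p = contradiction (trans (sym v) p) λ ()
    cases false false false c u v (suc i) p = ℕ.≤-trans (cost-bound m (A + A) (later ζ) (i , p))
      (ℕ.≤-reflexive (sym (contract m A ζ c u v)))

  levels-zeros : ∀ m A → cutLevels m A zeros ≡ 0
  levels-zeros zero    A = refl
  levels-zeros (suc m) A = trans (ℕC.levelSum-cong m ((λ _ → refl) ℕC., λ _ _ → refl))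
    (levels-zeros m (A + A))

  -- Only the edges `s c_k` with `k > 0` are cut, with values `A`, `2A`, `4A` and so on; a further
  -- `A` completes the geometric sum.
  levels-ones : ∀ m A → A + cutLevels m A ones ≡ unit m A
  levels-ones zero    A = ℕ.+-identityʳ A
  levels-ones (suc m) A = trans (sym (ℕ.+-assoc A A _))
    (trans (cong ((A + A) ℕ.+_) (ℕC.levelSum-cong m ((λ _ → refl) ℕC., λ _ _ → refl)))
      (levels-ones m (A + A)))

  tight-cost : ∀ {m ζ} A → Tight m ζ → cutCost m A ζ ≡ unit m A + unit m A
  tight-cost {zero}  A c-tight = refl
  tight-cost {zero}  A u-tight = refl
  tight-cost {m} A all-tight = cong (unit m A ℕ.+_) (levels-ones m A)
  tight-cost {suc m} A t = go t
    where
    N K : ℕ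
    N = unit (suc m) A
    K = N ∸ A
    K+A : K + A ≡ N
    K+A = ℕ.m∸n+n≡m (A≤unit (suc m) A)
    T≡0 : ∀ {W} → ℕC._≋_ W (ℕC.cuts (rooted zeros) (weight m (A + A))) → levelSum _+_ m W ≡ 0
    T≡0 e = trans (ℕC.levelSum-cong m e) (levels-zeros m (A + A))
    arith₁ : ∀ N K A {t} → K + A ≡ N → t ≡ 0 → N + (K + (A + t)) ≡ N + N
    arith₁ _ K A refl refl = lemma K A where
      lemma : ∀ K A → (K + A) + (K + (A + 0)) ≡ (K + A) + (K + A)
      lemma = solve-∀
    arith₂ : ∀ N K A {t} → K + A ≡ N → t ≡ 0 → A + (N + (K + t)) ≡ N + N
    arith₂ _ K A refl refl = lemma K A where
      lemma : ∀ K A → A + ((K + A) + (K + 0)) ≡ (K + A) + (K + A)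
      lemma = solve-∀
    arith₃ : ∀ N K A {t} → K + A ≡ N → t ≡ 0 → K + (N + (A + t)) ≡ N + N
    arith₃ _ K A refl refl = lemma K A where
      lemma : ∀ K A → K + ((K + A) + (A + 0)) ≡ (K + A) + (K + A)
      lemma = solve-∀
    arith₄ : ∀ N K A {t} → K + A ≡ N → t ≡ 0 → A + (K + (K + (A + t))) ≡ N + N
    arith₄ _ K A refl refl = lemma K A where
      lemma : ∀ K A → A + (K + (K + (A + 0))) ≡ (K + A) + (K + A)
      lemma = solve-∀
    arith₅ : ∀ N K A {t} → K + A ≡ N → (A + A) + t ≡ N → A + (K + (A + (A + t))) ≡ N + N
    arith₅ N K A {t} p q = trans (lemma K A t) (cong₂ _+_ p q) where
      lemma : ∀ K A t → A + (K + (A + (A + t))) ≡ (K + A) + ((A + A) + t)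
      lemma = solve-∀
    go : ∀ {ζ} → Tight (suc m) ζ → cutCost (suc m) A ζ ≡ N + N
    go c-tight     = arith₁ N K A K+A (T≡0 ((λ _ → refl) ℕC., λ _ _ → refl))
    go u-tight     = arith₂ N K A K+A (T≡0 ((λ _ → refl) ℕC., λ _ _ → refl))
    go v-tight     = arith₃ N K A K+A (T≡0 ((λ _ → refl) ℕC., λ _ _ → refl))
    go uv-tight    = arith₄ N K A K+A (T≡0 ((λ _ → refl) ℕC., λ _ _ → refl))
    go all-tight   = cong (N ℕ.+_) (levels-ones (suc m) A)
    go but-c-tight = arith₅ N K A K+A (trans (cong ((A + A) ℕ.+_)
      (ℕC.levelSum-cong m ((λ _ → refl) ℕC., λ _ _ → refl))) (levels-ones m (A + A)))
    go (later-tight {ζ = ζ} t) = trans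
      (contract m A (false ∷ false ∷ false ∷ ζ) refl refl refl) (tight-cost (A + A) t)

open Costs using (ℕ-sums; cutCost; cost-bound; tight-cost)

-- The ordered ring of Cauchy reals

open import Defs
open CauchySequences
open +-*-Solver using (solve; con; _:=_; _:+_; _:*_; _:-_; :-_)

∣p∣<-intro : ∀ {p q} → p ℚ.< q → ℚ.- p ℚ.< q → ℚ.∣ p ∣ ℚ.< q
∣p∣<-intro {p} {q} p<q -p<q with ℚ.∣p∣≡p∨∣p∣≡-p p
... | inj₁ eq = subst (ℚ._< q) (sym eq) p<q
... | inj₂ eq = subst (ℚ._< q) (sym eq) -p<q

∣p∣<-elim : ∀ {p q} → ℚ.∣ p ∣ ℚ.< q → p ℚ.< q
∣p∣<-elim {p} = ℚ.≤-<-trans p≤∣p∣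
  where
  p≤∣p∣ : p ℚ.≤ ℚ.∣ p ∣
  p≤∣p∣ with ℚ.≤-total 0ℚ p
  ... | inj₁ 0≤p = ℚ.≤-reflexive (sym (ℚ.0≤p⇒∣p∣≡p 0≤p))
  ... | inj₂ p≤0 = ℚ.≤-trans p≤0 (ℚ.0≤∣p∣ p)

both : ∀ {P Q : ℕ → Set} → Eventually P → Eventually Q → Eventually (λ n → P n × Q n)
both (M , p) (N , q) = M ℕ.⊔ N , λ n ≥ →
  p n (ℕ.m⊔n≤o⇒m≤o M N ≥) , q n (ℕ.m⊔n≤o⇒n≤o M N ≥)

weaken : ∀ {P Q : ℕ → Set} → (∀ n → P n → Q n) → Eventually P → Eventually Q
weaken f (N , p) = N , λ n ≥ → f n (p n ≥)

pointwise : ∀ x y → (∀ n → seq x n ≡ seq y n) → x ≈ y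
pointwise x y eq ε 0<ε = 0 , λ n _ → subst (λ d → ℚ.∣ d ∣ ℚ.< ε)
  (sym (trans (cong (ℚ._- seq y n) (eq n)) (ℚ.+-inverseʳ (seq y n)))) 0<ε

≈-refl : ∀ x → x ≈ x
≈-refl x = pointwise x x λ _ → refl

≈-sym : ∀ x y → x ≈ y → y ≈ x
≈-sym x y x≈y ε 0<ε = weaken (λ n → subst (ℚ._< ε)
  (trans (sym (ℚ.∣-p∣≡∣p∣ (seq x n ℚ.- seq y n)))
    (cong ℚ.∣_∣ (solve 2 (λ s t → :- (s :- t) := t :- s) refl (seq x n) (seq y n)))))
  (x≈y ε 0<ε)

close-+ : ∀ s t u v {h} → ℚ.∣ s ℚ.- u ∣ ℚ.< ½ ℚ.* h → ℚ.∣ t ℚ.- v ∣ ℚ.< ½ ℚ.* h →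
          ℚ.∣ (s ℚ.+ t) ℚ.- (u ℚ.+ v) ∣ ℚ.< h
close-+ s t u v {h} p q = begin-strict
  ℚ.∣ (s ℚ.+ t) ℚ.- (u ℚ.+ v) ∣
    ≡⟨ cong ℚ.∣_∣ (solve 4 (λ s t u v → (s :+ t) :- (u :+ v) := (s :- u) :+ (t :- v)) refl s t u v) ⟩
  ℚ.∣ (s ℚ.- u) ℚ.+ (t ℚ.- v) ∣       ≤⟨ ℚ.∣p+q∣≤∣p∣+∣q∣ (s ℚ.- u) (t ℚ.- v) ⟩
  ℚ.∣ s ℚ.- u ∣ ℚ.+ ℚ.∣ t ℚ.- v ∣     <⟨ ℚ.+-mono-< p q ⟩
  ½ ℚ.* h ℚ.+ ½ ℚ.* h                 ≡⟨ half-sum h ⟩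
  h                                   ∎
  where open ℚ.≤-Reasoning

≈-trans : ∀ x y z → x ≈ y → y ≈ z → x ≈ z
≈-trans x y z x≈y y≈z ε 0<ε = weaken
  (λ n (p , q) → subst (λ d → ℚ.∣ d ∣ ℚ.< ε)
    (solve 3 (λ a b c → (a :+ b) :- (b :+ c) := a :- c) refl (seq x n) (seq y n) (seq z n))
    (close-+ (seq x n) (seq y n) (seq y n) (seq z n) p q))
  (both (x≈y (½ ℚ.* ε) (half-pos 0<ε)) (y≈z (½ ℚ.* ε) (half-pos 0<ε)))

≈-isEquivalence : IsEquivalence _≈_
≈-isEquivalence = record
  { refl  = λ {x} → ≈-refl x
  ; sym   = λ {x} {y} → ≈-sym x y
  ; trans = λ {x} {y} {z} → ≈-trans x y z
  }

+-congruent : ∀ x x′ y y′ → x ≈ x′ → y ≈ y′ → x + y ≈ x′ + y′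
+-congruent x x′ y y′ p q ε 0<ε = weaken
  (λ n (a , b) → close-+ (seq x n) (seq y n) (seq x′ n) (seq y′ n) a b)
  (both (p (½ ℚ.* ε) (half-pos 0<ε)) (q (½ ℚ.* ε) (half-pos 0<ε)))

neg-congruent : ∀ x y → x ≈ y → - x ≈ - y
neg-congruent x y p ε 0<ε = weaken (λ n → subst (ℚ._< ε)
  (trans (sym (ℚ.∣-p∣≡∣p∣ (seq x n ℚ.- seq y n)))
    (cong ℚ.∣_∣ (solve 2 (λ s t → :- (s :- t) := (:- s) :- (:- t)) refl (seq x n) (seq y n)))))
  (p ε 0<ε)

*-congruent : ∀ x x′ y y′ → x ≈ x′ → y ≈ y′ → x * y ≈ x′ * y′
*-congruent x x′ y y′ p q ε 0<ε =
  let A , 0<A , x≤A = bounded {seq x} (cauchy x)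
      B , 0<B , y≤B = bounded {seq y′} (cauchy y′)
      h = ½ ℚ.* ε
  in weaken (λ n ((x≤ , y≤) , (a , b)) → subst
       (λ d → ℚ.∣ seq x n ℚ.* seq y n ℚ.- seq x′ n ℚ.* seq y′ n ∣ ℚ.< d)
       (half-sum ε) (*-close (seq x n) (seq y n) (seq x′ n) (seq y′ n) h 0<A 0<B x≤ y≤ a b))
     (both (both x≤A y≤B) (both
       (p (inv B ℚ.* h) (*-pos (inv-pos 0<B) (half-pos 0<ε)))
       (q (inv A ℚ.* h) (*-pos (inv-pos 0<A) (half-pos 0<ε)))))

ℝ-commutativeRing : CommutativeRing 0ℓ 0ℓ
ℝ-commutativeRing = record
  { Carrier = ℝ ; _≈_ = _≈_ ; _+_ = _+_ ; _*_ = _*_ ; -_ = -_ ; 0# = 0ℝ ; 1# = 1ℝ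
  ; isCommutativeRing = record
    { isRing = record
      { +-isAbelianGroup = record
        { isGroup = record
          { isMonoid = record
            { isSemigroup = record
              { isMagma = record
                { isEquivalence = ≈-isEquivalence
                ; ∙-cong = λ {x} {x′} {y} {y′} → +-congruent x x′ y y′
                }
              ; assoc = λ x y z → pointwise ((x + y) + z) (x + (y + z)) λ n →
                  ℚ.+-assoc (seq x n) (seq y n) (seq z n)
              }
            ; identity = (λ x → pointwise (0ℝ + x) x λ n → ℚ.+-identityˡ (seq x n)) ,
                (λ x → pointwise (x + 0ℝ) x λ n → ℚ.+-identityʳ (seq x n))
            }
          ; inverse = (λ x → pointwise (- x + x) 0ℝ λ n → ℚ.+-inverseˡ (seq x n)) ,
              (λ x → pointwise (x + - x) 0ℝ λ n → ℚ.+-inverseʳ (seq x n))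
          ; ⁻¹-cong = λ {x} {y} → neg-congruent x y
          }
        ; comm = λ x y → pointwise (x + y) (y + x) λ n → ℚ.+-comm (seq x n) (seq y n)
        }
      ; *-cong = λ {x} {x′} {y} {y′} → *-congruent x x′ y y′
      ; *-assoc = λ x y z → pointwise ((x * y) * z) (x * (y * z)) λ n →
          ℚ.*-assoc (seq x n) (seq y n) (seq z n)
      ; *-identity = (λ x → pointwise (1ℝ * x) x λ n → ℚ.*-identityˡ (seq x n)) ,
          (λ x → pointwise (x * 1ℝ) x λ n → ℚ.*-identityʳ (seq x n))
      ; distrib = (λ x y z → pointwise (x * (y + z)) (x * y + x * z) λ n →
            ℚ.*-distribˡ-+ (seq x n) (seq y n) (seq z n)) ,
          (λ x y z → pointwise ((y + z) * x) (y * x + z * x) λ n →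
            ℚ.*-distribʳ-+ (seq x n) (seq y n) (seq z n))
      }
    ; *-comm = λ x y → pointwise (x * y) (y * x) λ n → ℚ.*-comm (seq x n) (seq y n)
    }
  }

halve : ∀ x → x + x ≈ 0ℝ → x ≈ 0ℝ
halve x 2x≈0 = ≈-trans x (fromℚ ½ * (x + x)) 0ℝ
  (pointwise x (fromℚ ½ * (x + x)) λ n →
    sym (trans (ℚ.*-distribˡ-+ ½ (seq x n) (seq x n)) (half-sum (seq x n))))
  (≈-trans (fromℚ ½ * (x + x)) (fromℚ ½ * 0ℝ) 0ℝ
    (*-congruent (fromℚ ½) (fromℚ ½) (x + x) 0ℝ (≈-refl (fromℚ ½)) 2x≈0)
    (pointwise (fromℚ ½ * 0ℝ) 0ℝ λ _ → refl))

≤-respʳ-≈ : ∀ x y z → y ≈ z → x ≤ y → x ≤ z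
≤-respʳ-≈ x y z y≈z x≤y ε 0<ε = weaken (λ n (p , q) → begin
    seq x n                                     ≤⟨ p ⟩
    seq y n ℚ.+ ½ ℚ.* ε
      ≡⟨ solve 3 (λ y z e → y :+ e := (y :- z) :+ (z :+ e)) refl (seq y n) (seq z n) (½ ℚ.* ε) ⟩
    (seq y n ℚ.- seq z n) ℚ.+ (seq z n ℚ.+ ½ ℚ.* ε)
      ≤⟨ ℚ.+-monoˡ-≤ (seq z n ℚ.+ ½ ℚ.* ε) (ℚ.<⇒≤ (∣p∣<-elim {seq y n ℚ.- seq z n} q)) ⟩
    ½ ℚ.* ε ℚ.+ (seq z n ℚ.+ ½ ℚ.* ε)
      ≡⟨ solve 2 (λ h z → h :+ (z :+ h) := z :+ (h :+ h)) refl (½ ℚ.* ε) (seq z n) ⟩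
    seq z n ℚ.+ (½ ℚ.* ε ℚ.+ ½ ℚ.* ε)           ≡⟨ cong (seq z n ℚ.+_) (half-sum ε) ⟩
    seq z n ℚ.+ ε                               ∎)
  (both (x≤y (½ ℚ.* ε) (half-pos 0<ε)) (y≈z (½ ℚ.* ε) (half-pos 0<ε)))
  where open ℚ.≤-Reasoning

≤-respˡ-≈ : ∀ x y z → x ≈ z → x ≤ y → z ≤ y
≤-respˡ-≈ x y z x≈z x≤y ε 0<ε = weaken (λ n (p , q) → begin
    seq z n
      ≡⟨ solve 2 (λ x z → z := (z :- x) :+ x) refl (seq x n) (seq z n) ⟩
    (seq z n ℚ.- seq x n) ℚ.+ seq x n
      ≤⟨ ℚ.+-mono-≤ (ℚ.<⇒≤ (∣p∣<-elim {seq z n ℚ.- seq x n} q)) p ⟩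
    ½ ℚ.* ε ℚ.+ (seq y n ℚ.+ ½ ℚ.* ε)
      ≡⟨ solve 2 (λ h z → h :+ (z :+ h) := z :+ (h :+ h)) refl (½ ℚ.* ε) (seq y n) ⟩
    seq y n ℚ.+ (½ ℚ.* ε ℚ.+ ½ ℚ.* ε)           ≡⟨ cong (seq y n ℚ.+_) (half-sum ε) ⟩
    seq y n ℚ.+ ε                               ∎)
  (both (x≤y (½ ℚ.* ε) (half-pos 0<ε)) (≈-sym x z x≈z (½ ℚ.* ε) (half-pos 0<ε)))
  where open ℚ.≤-Reasoning

pointwise-≤ : ∀ x y → (∀ n → seq x n ℚ.≤ seq y n) → x ≤ y
pointwise-≤ x y p ε 0<ε = 0 , λ n _ → ℚ.≤-trans (p n)
  (subst (ℚ._≤ seq y n ℚ.+ ε) (ℚ.+-identityʳ (seq y n)) (ℚ.+-monoʳ-≤ (seq y n) (ℚ.<⇒≤ 0<ε)))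

-- Since `s + t = 1`, `s (a - c)` equals `(s a + t b - c) + t (c - b)`. Both terms are at most `η`,
-- and `2 η = σ ε` is at most `s ε`, so `s` cancels. The other direction follows from `c ≤ a + η`.
pinch-ℚ : ∀ s t a b c σ ε → 0ℚ ℚ.< ε → 0ℚ ℚ.< σ → σ ℚ.≤ s → 0ℚ ℚ.≤ t → s ℚ.+ t ≡ 1ℚ →
  let η = ½ ℚ.* (σ ℚ.* ε) in
  c ℚ.≤ a ℚ.+ η → c ℚ.≤ b ℚ.+ η → ℚ.∣ c ℚ.- (s ℚ.* a ℚ.+ t ℚ.* b) ∣ ℚ.< η →
  ℚ.∣ a ℚ.- c ∣ ℚ.< ε
pinch-ℚ s t a b c σ ε 0<ε 0<σ σ≤s 0≤t s+t≡1 c≤a c≤b close = ∣p∣<-intro upper lower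
  where
  open ℚ.≤-Reasoning
  η = ½ ℚ.* (σ ℚ.* ε)
  0<η : 0ℚ ℚ.< η
  0<η = half-pos (*-pos 0<σ 0<ε)
  0<s : 0ℚ ℚ.< s
  0<s = ℚ.<-≤-trans 0<σ σ≤s
  t≤1 : t ℚ.≤ 1ℚ
  t≤1 = begin
    t         ≡⟨ ℚ.+-identityˡ t ⟨
    0ℚ ℚ.+ t  ≤⟨ ℚ.+-monoˡ-≤ t (ℚ.<⇒≤ 0<s) ⟩
    s ℚ.+ t   ≡⟨ s+t≡1 ⟩
    1ℚ        ∎
  s≤1 : s ℚ.≤ 1ℚ
  s≤1 = begin
    s         ≡⟨ ℚ.+-identityʳ s ⟨
    s ℚ.+ 0ℚ  ≤⟨ ℚ.+-monoʳ-≤ s 0≤t ⟩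
    s ℚ.+ t   ≡⟨ s+t≡1 ⟩
    1ℚ        ∎
  lower : ℚ.- (a ℚ.- c) ℚ.< ε
  lower = begin-strict
    ℚ.- (a ℚ.- c)          ≡⟨ solve 2 (λ a c → :- (a :- c) := c :- a) refl a c ⟩
    c ℚ.- a                ≤⟨ ℚ.+-monoˡ-≤ (ℚ.- a) c≤a ⟩
    (a ℚ.+ η) ℚ.- a        ≡⟨ solve 2 (λ a e → (a :+ e) :- a := e :+ con 0ℚ) refl a η ⟩
    η ℚ.+ 0ℚ               <⟨ ℚ.+-monoʳ-< η 0<η ⟩
    η ℚ.+ η                ≡⟨ half-sum (σ ℚ.* ε) ⟩
    σ ℚ.* ε                ≤⟨ ℚ.*-monoʳ-≤-nonNeg ε {{ℚ.nonNegative (ℚ.<⇒≤ 0<ε)}} (ℚ.≤-trans σ≤s s≤1) ⟩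
    1ℚ ℚ.* ε               ≡⟨ ℚ.*-identityˡ ε ⟩
    ε                      ∎
  comb = s ℚ.* a ℚ.+ t ℚ.* b
  upper : a ℚ.- c ℚ.< ε
  upper = ℚ.*-cancelˡ-<-nonNeg s {{ℚ.nonNegative (ℚ.<⇒≤ 0<s)}} (begin-strict
    s ℚ.* (a ℚ.- c)
      ≡⟨ solve 5 (λ s t a b c → s :* (a :- c) :=
           (:- (c :- (s :* a :+ t :* b))) :+ (t :* (c :- b) :+ (c :- (s :+ t) :* c))) refl s t a b c ⟩
    (ℚ.- (c ℚ.- comb)) ℚ.+ (t ℚ.* (c ℚ.- b) ℚ.+ (c ℚ.- (s ℚ.+ t) ℚ.* c))
      ≡⟨ cong (λ k → (ℚ.- (c ℚ.- comb)) ℚ.+ (t ℚ.* (c ℚ.- b) ℚ.+ (c ℚ.- k ℚ.* c))) s+t≡1 ⟩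
    (ℚ.- (c ℚ.- comb)) ℚ.+ (t ℚ.* (c ℚ.- b) ℚ.+ (c ℚ.- 1ℚ ℚ.* c))
      ≡⟨ cong ((ℚ.- (c ℚ.- comb)) ℚ.+_)
           (solve 2 (λ p c → p :+ (c :- con 1ℚ :* c) := p) refl (t ℚ.* (c ℚ.- b)) c) ⟩
    (ℚ.- (c ℚ.- comb)) ℚ.+ t ℚ.* (c ℚ.- b)
      <⟨ ℚ.+-mono-<-≤ (∣p∣<-elim {ℚ.- (c ℚ.- comb)}
           (subst (ℚ._< η) (sym (ℚ.∣-p∣≡∣p∣ (c ℚ.- comb))) close)) tcb ⟩
    η ℚ.+ η
      ≡⟨ half-sum (σ ℚ.* ε) ⟩
    σ ℚ.* ε
      ≤⟨ ℚ.*-monoʳ-≤-nonNeg ε {{ℚ.nonNegative (ℚ.<⇒≤ 0<ε)}} σ≤s ⟩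
    s ℚ.* ε ∎)
    where
    tcb : t ℚ.* (c ℚ.- b) ℚ.≤ η
    tcb = begin
      t ℚ.* (c ℚ.- b)          ≤⟨ ℚ.*-monoˡ-≤-nonNeg t {{ℚ.nonNegative 0≤t}} (ℚ.+-monoˡ-≤ (ℚ.- b) c≤b) ⟩
      t ℚ.* ((b ℚ.+ η) ℚ.- b)  ≡⟨ cong (t ℚ.*_) (solve 2 (λ a e → (a :+ e) :- a := e) refl b η) ⟩
      t ℚ.* η                  ≤⟨ ℚ.*-monoʳ-≤-nonNeg η {{ℚ.nonNegative (ℚ.<⇒≤ 0<η)}} t≤1 ⟩
      1ℚ ℚ.* η                 ≡⟨ ℚ.*-identityˡ η ⟩
      η                        ∎

pinch : ∀ s t a b c → 0ℝ < s → 0ℝ < t → (∀ n → seq s n ℚ.+ seq t n ≡ 1ℚ) →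
  c ≤ a → c ≤ b → c ≈ s * a + t * b → a ≈ c
pinch s t a b c (σ , 0<σ , σ≤) (τ , 0<τ , τ≤) s+t c≤a c≤b c≈ ε 0<ε = weaken
  (λ n ((p , q) , ((u , v) , w)) → pinch-ℚ (seq s n) (seq t n) (seq a n) (seq b n) (seq c n) σ ε 0<ε 0<σ
    (subst (ℚ._≤ seq s n) (ℚ.+-identityˡ σ) p)
    (ℚ.≤-trans (ℚ.<⇒≤ 0<τ) (subst (ℚ._≤ seq t n) (ℚ.+-identityˡ τ) q))
    (s+t n) u v w)
  (both (both σ≤ τ≤) (both (both (c≤a η 0<η) (c≤b η 0<η)) (c≈ η 0<η)))
  where
  η = ½ ℚ.* (σ ℚ.* ε)
  0<η : 0ℚ ℚ.< η
  0<η = half-pos (*-pos 0<σ 0<ε)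

complement-pos : ∀ t → t < 1ℝ → 0ℝ < 1ℝ - t
complement-pos t (ε , 0<ε , N , p) = ε , 0<ε , N , λ n ≥ → begin
    0ℚ ℚ.+ ε                        ≡⟨ solve 2 (λ e t → con 0ℚ :+ e := (t :+ e) :- t) refl ε (seq t n) ⟩
    (seq t n ℚ.+ ε) ℚ.- seq t n     ≤⟨ ℚ.+-monoˡ-≤ (ℚ.- seq t n) (p n ≥) ⟩
    1ℚ ℚ.- seq t n                  ∎
  where open ℚ.≤-Reasoning

-- The mechanism of extremality: a constraint that is tight at a convex combination is tight at both
-- of its ends.
pinch-convex : ∀ t a b c → 0ℝ < t → t < 1ℝ → c ≤ a → c ≤ b → c ≈ t * a + (1ℝ - t) * b →
  a ≈ c × b ≈ c
pinch-convex t a b c 0<t t<1 c≤a c≤b c≈ =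
  pinch t (1ℝ - t) a b c 0<t 0<1-t (λ n → solve 1 (λ t → t :+ (con 1ℚ :- t) := con 1ℚ) refl (seq t n))
    c≤a c≤b c≈ ,
  pinch (1ℝ - t) t b a c 0<1-t 0<t (λ n → solve 1 (λ t → (con 1ℚ :- t) :+ t := con 1ℚ) refl (seq t n))
    c≤b c≤a (≈-trans c (t * a + (1ℝ - t) * b) ((1ℝ - t) * b + t * a) c≈
      (pointwise (t * a + (1ℝ - t) * b) ((1ℝ - t) * b + t * a) λ n →
        ℚ.+-comm (seq (t * a) n) (seq ((1ℝ - t) * b) n)))
  where 0<1-t = complement-pos t t<1

-- The extreme points

ℝ-sums : CommutativeMonoid 0ℓ 0ℓ
ℝ-sums = CommutativeRing.+-commutativeMonoid ℝ-commutativeRing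

module ℝC = Cuts ℝ-sums
module ≈-Reasoning = SetoidReasoning (CommutativeRing.setoid ℝ-commutativeRing)
module ℝL = Linear ℝ-commutativeRing

open RawMonoidDefs ℚ.+-0-rawMonoid using () renaming (_×_ to _·_)
open Mult ℚ.+-0-monoid using (×-homo-+)

-- This is `2^(-m) q`, by a recursion that mirrors `unit`.
halved : ℕ → ℚ → ℚ
halved zero    q = q
halved (suc m) q = halved m (½ ℚ.* q)

unit·halved : ∀ m A q → unit m A · halved m q ≡ A · q
unit·halved zero    A q = refl
unit·halved (suc m) A q = trans (unit·halved m (A ℕ.+ A) (½ ℚ.* q))
  (trans (×-homo-+ (½ ℚ.* q) A A) (double A))
  where
  double : ∀ A → A · (½ ℚ.* q) ℚ.+ A · (½ ℚ.* q) ≡ A · q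
  double zero    = refl
  double (suc A) = trans
    (solve 2 (λ h r → (h :+ r) :+ (h :+ r) := (h :+ h) :+ (r :+ r)) refl (½ ℚ.* q) (A · (½ ℚ.* q)))
    (cong₂ ℚ._+_ (half-sum q) (double A))

halved-pos : ∀ m {q} → 0ℚ ℚ.< q → 0ℚ ℚ.< halved m q
halved-pos zero    0<q = 0<q
halved-pos (suc m) 0<q = halved-pos m (half-pos 0<q)

·-mono : ∀ {q k l} → 0ℚ ℚ.≤ q → k ℕ.≤ l → k · q ℚ.≤ l · q
·-mono {q} {l = zero}  0≤q z≤n       = ℚ.≤-refl
·-mono {q} {l = suc l} 0≤q z≤n       = ℚ.≤-trans (ℚ.≤-reflexive (sym (ℚ.+-identityˡ 0ℚ)))
  (ℚ.+-mono-≤ 0≤q (·-mono {q} {0} {l} 0≤q z≤n))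
·-mono {q}             0≤q (s≤s k≤l) = ℚ.+-monoʳ-≤ q (·-mono 0≤q k≤l)

-- Undoes the scaling of the weights: `unit m 1` is sent to 1.
value : ℕ → ℕ → ℝ
value m k = fromℚ (k · halved m 1ℚ)

value-+ : ∀ m k l → value m (k ℕ.+ l) ≈ value m k + value m l
value-+ m k l = pointwise (value m (k ℕ.+ l)) (value m k + value m l) λ _ → ×-homo-+ (halved m 1ℚ) k l

value-mono : ∀ m {k l} → k ℕ.≤ l → value m k ≤ value m l
value-mono m {k} {l} k≤l = pointwise-≤ (value m k) (value m l) λ _ →
  ·-mono (ℚ.<⇒≤ (halved-pos m (ℚ.positive⁻¹ 1ℚ))) k≤l

value-unit : ∀ m → value m (unit m 1 ℕ.+ unit m 1) ≈ 2ℝ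
value-unit m = pointwise (value m (unit m 1 ℕ.+ unit m 1)) 2ℝ λ _ → trans
  (×-homo-+ (halved m 1ℚ) (unit m 1) (unit m 1))
  (cong₂ ℚ._+_ (unit·halved m 1 1ℚ) (unit·halved m 1 1ℚ))

point : ∀ m → Edge (order m) → ℝ
point m e = value m (weight m 1 (lo e) (hi e))

-- Needed because `matrix` puts 0 at every pair that is not in increasing order.
weight-≥ : ∀ m A (i j : Vertex m) → Fin.toℕ j ℕ.≤ Fin.toℕ i → weight m A i j ≡ 0
weight-≥ zero A 0F 0F _ = refl
weight-≥ zero A 1F 0F _ = refl
weight-≥ zero A 1F 1F _ = refl
weight-≥ zero A 2F 0F _ = refl
weight-≥ zero A 2F 1F _ = refl
weight-≥ zero A 2F 2F _ = refl
weight-≥ zero A 1F 2F (s≤s ())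
weight-≥ (suc m) A 0F 0F _ = refl
weight-≥ (suc m) A 1F 0F _ = refl
weight-≥ (suc m) A 1F 1F _ = refl
weight-≥ (suc m) A 1F (suc (suc j)) (s≤s ())
weight-≥ (suc m) A 2F 0F _ = refl
weight-≥ (suc m) A 2F 1F _ = refl
weight-≥ (suc m) A 2F 2F _ = refl
weight-≥ (suc m) A 2F (3+ j) (s≤s (s≤s ()))
weight-≥ (suc m) A 3F 0F _ = refl
weight-≥ (suc m) A 3F 1F _ = refl
weight-≥ (suc m) A 3F 2F _ = refl
weight-≥ (suc m) A 3F 3F _ = refl
weight-≥ (suc m) A 3F (4+ j) (s≤s (s≤s (s≤s ())))
weight-≥ (suc m) A (4+ i) 0F _ = refl
weight-≥ (suc m) A (4+ i) 1F _ = refl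
weight-≥ (suc m) A (4+ i) 2F _ = refl
weight-≥ (suc m) A (4+ i) 3F _ = refl
weight-≥ (suc m) A (4+ i) (4+ j) (s≤s (s≤s (s≤s p))) =
  weight-≥ m (A ℕ.+ A) (suc i) (suc j) p

matrix : ∀ {n} → (Edge n → ℝ) → Fin n → Fin n → ℝ
matrix y i j with i Fin.<? j
... | yes i<j = y (edge i j i<j)
... | no  _   = 0ℝ

matrix-edge : ∀ {n} (y : Edge n → ℝ) e → matrix y (lo e) (hi e) ≡ y e
matrix-edge y (edge i j i<j) with i Fin.<? j
... | yes _  = refl
... | no i≮j = contradiction-irr i<j i≮j
  where
  open import Relation.Nullary.Negation.Core using (contradiction-irr)

entry-matrix : ∀ {n} (y : Edge n → ℝ) S i j →
  entry y (δ S) i j ≡ ℝC.cuts (lookup S) (matrix y) i j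
entry-matrix y S i j with i Fin.<? j
... | yes _ = refl
... | no  _ with lookup S i xor lookup S j
...   | true  = refl
...   | false = refl

Vanishing : ∀ m → (Edge (order m) → ℝ) → Set
Vanishing m y = ∀ e → weight m 1 (lo e) (hi e) ≡ 0 → y e ≈ 0ℝ

matrix-zero : ∀ m {y} → Vanishing m y → ∀ i j → weight m 1 i j ≡ 0 → matrix y i j ≈ 0ℝ
matrix-zero m vanish i j eq with i Fin.<? j
... | yes i<j = vanish (edge i j i<j) eq
... | no  _   = ≈-refl 0ℝ

matrix-sparse : ∀ m {y} → Vanishing m y → ℝC.Sparse m 1 (matrix y)
matrix-sparse m {y} vanish = (λ j → matrix-zero m {y} vanish 0F (3+ j)) ,
  λ i j → matrix-zero m {y} vanish (suc i) (suc j)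

cancel-xor : ∀ b p q → (b xor p) xor (b xor q) ≡ p xor q
cancel-xor false p q     = refl
cancel-xor true  false q = not-involutive q
cancel-xor true  true  q = refl

cut-xor : ∀ b p q x → ℝC.cut (b xor p) (b xor q) x ≡ ℝC.cut p q x
cut-xor b p q x = cong (if_then x else 0ℝ) (cancel-xor b p q)

-- Exchanging the two sides does not change a cut; `b` tells whether `S` contains the root, and `ζ`
-- is the side without it.
boundary : ∀ m {y} S b ζ → Vanishing m y → (∀ i → lookup S i ≡ b xor rooted ζ i) →
  y ⟨ δ S ⟩ ≈ ℝC.cost m ζ (matrix y 0F 1F) (matrix y 0F 2F) (matrix y)
boundary m {y} S b ζ vanish S≡ = begin
  y ⟨ δ S ⟩
    ≡⟨ sum-cong-≗ (λ i → sum-cong-≗ λ j → trans (entry-matrix y S i j)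
         (trans (cong₂ (λ p q → ℝC.cut p q (matrix y i j)) (S≡ i) (S≡ j))
           (cut-xor b (rooted ζ i) (rooted ζ j) (matrix y i j)))) ⟩
  ℝC.total W
    ≈⟨ ℝC.total-sparse m {1} {W} (ℝC.cuts-sparse m (rooted ζ) {matrix y} (matrix-sparse m {y} vanish))
         (≈-refl 0ℝ) (λ i → ℝC.cut-zero (ζ i) false {matrix y (suc i) 0F} (≈-refl 0ℝ)) ⟩
  ℝC.cost m ζ (matrix y 0F 1F) (matrix y 0F 2F) (matrix y) ∎
  where
  open ≈-Reasoning
  open Sum ℝ-sums using (sum-cong-≗)
  W = ℝC.cuts (rooted ζ) (matrix y)

point-vanishing : ∀ m → Vanishing m (point m)
point-vanishing m e eq = pointwise (point m e) 0ℝ λ _ → cong (_· halved m 1ℚ) eq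

matrix-point : ∀ m i j → matrix (point m) i j ≡ value m (weight m 1 i j)
matrix-point m i j with i Fin.<? j
... | yes i<j = refl
... | no  i≮j = cong (value m) (sym (weight-≥ m 1 i j (ℕ.≮⇒≥ i≮j)))

weight-01 : ∀ m A → weight m A 0F 1F ≡ unit m A
weight-01 zero    A = refl
weight-01 (suc m) A = refl

weight-02 : ∀ m A → weight m A 0F 2F ≡ A
weight-02 zero    A = refl
weight-02 (suc m) A = refl

point-boundary : ∀ m S b ζ → (∀ i → lookup S i ≡ b xor rooted ζ i) →
  point m ⟨ δ S ⟩ ≈ value m (cutCost m 1 ζ)
point-boundary m S b ζ S≡ = begin
  point m ⟨ δ S ⟩
    ≈⟨ boundary m {point m} S b ζ (point-vanishing m) S≡ ⟩
  ℝC.cost m ζ (matrix (point m) 0F 1F) (matrix (point m) 0F 2F) (matrix (point m))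
    ≡⟨ cong₂ (λ d₁ d₂ → ℝC.cost m ζ d₁ d₂ (matrix (point m)))
         (trans (matrix-point m 0F 1F) (cong (value m) (weight-01 m 1)))
         (trans (matrix-point m 0F 2F) (cong (value m) (weight-02 m 1))) ⟩
  ℝC.cost m ζ (value m (unit m 1)) (value m 1) (matrix (point m))
    ≈⟨ CommutativeRing.+-congˡ ℝ-commutativeRing {c₁} {c₂ + t₁} {c₂ + t₂}
         (CommutativeRing.+-congˡ ℝ-commutativeRing {c₂} {t₁} {t₂}
         (ℝC.levelSum-cong m {ℝC.cuts (rooted ζ) (matrix (point m))}
           {ℝC.cuts (rooted ζ) (λ i j → value m (weight m 1 i j))}
           ((λ j → eq 0F (3+ j)) ℝC., λ i j → eq (suc i) (suc j)))) ⟩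
  ℝC.cost m ζ (value m (unit m 1)) (value m 1) (λ i j → value m (weight m 1 i j))
    ≈⟨ Homomorphism.cost-homo ℕ-sums ℝ-sums (value m) (value-+ m) (≈-refl 0ℝ) m ζ _ _ (weight m 1) ⟩
  value m (cutCost m 1 ζ) ∎
  where
  open ≈-Reasoning
  c₁ = ℝC.cut false (ζ 0F) (value m (unit m 1))
  c₂ = ℝC.cut false (ζ 1F) (value m 1)
  t₁ = levelSum _+_ m (ℝC.cuts (rooted ζ) (matrix (point m)))
  t₂ = levelSum _+_ m (ℝC.cuts (rooted ζ) (λ i j → value m (weight m 1 i j)))
  eq : ∀ i j → ℝC.cuts (rooted ζ) (matrix (point m)) i j ≈
               ℝC.cuts (rooted ζ) (λ i j → value m (weight m 1 i j)) i j
  eq i j = CommutativeRing.reflexive ℝ-commutativeRing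
    (cong (ℝC.cut (rooted ζ i) (rooted ζ j)) (matrix-point m i j))

point-tight : ∀ m {ζ} S b → Tight m ζ → (∀ i → lookup S i ≡ b xor rooted ζ i) →
  point m ⟨ δ S ⟩ ≈ 2ℝ
point-tight m {ζ} S b t S≡ = begin
  point m ⟨ δ S ⟩                     ≈⟨ point-boundary m S b ζ S≡ ⟩
  value m (cutCost m 1 ζ)             ≡⟨ cong (value m) (tight-cost 1 t) ⟩
  value m (unit m 1 ℕ.+ unit m 1)     ≈⟨ value-unit m ⟩
  2ℝ                                  ∎
  where open ≈-Reasoning

b-xor-b-xor : ∀ b s → s ≡ b xor (b xor s)
b-xor-b-xor false s = refl
b-xor-b-xor true  s = sym (not-involutive s)

-- The side of the cut that avoids the root: `S` is complemented when it contains the root.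
relative : ∀ {n} → Subset (suc n) → Vector Bool n
relative S i = lookup S zero xor lookup S (suc i)

lookup-relative : ∀ {n} (S : Subset (suc n)) i → lookup S i ≡ lookup S zero xor rooted (relative S) i
lookup-relative S zero    = sym (xor-identityʳ (lookup S zero))
lookup-relative S (suc i) = b-xor-b-xor (lookup S zero) (lookup S (suc i))

-- A member of `S` serves if the root is outside `S`, and a vertex missing from `S` otherwise.
relative-nonempty : ∀ {n} (S : Subset (suc n)) → Nonempty S → S ⊂ ⊤ → ∃ λ i → relative S i ≡ true
relative-nonempty S (k , k∈S) (_ , l , _ , l∉S) = cases (lookup S zero) refl k l
    (Vec.[]=⇒lookup k∈S) (¬-not λ eq → l∉S (Vec.lookup⇒[]= l S eq))
  where
  cases : ∀ b → lookup S zero ≡ b → ∀ k l → lookup S k ≡ true → lookup S l ≡ false →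
    ∃ λ i → relative S i ≡ true
  cases false eq zero    l       p q = contradiction (trans (sym eq) p) λ ()
  cases false eq (suc k) l       p q = k , cong₂ _xor_ eq p
  cases true  eq k       zero    p q = contradiction (trans (sym eq) q) λ ()
  cases true  eq k       (suc l) p q = l , cong₂ _xor_ eq q

point-cut : ∀ m S → Nonempty S → S ⊂ ⊤ → 2ℝ ≤ point m ⟨ δ S ⟩
point-cut m S ne pr = ≤-respʳ-≈ 2ℝ (value m (cutCost m 1 (relative S))) (point m ⟨ δ S ⟩)
  (≈-sym (point m ⟨ δ S ⟩) (value m (cutCost m 1 (relative S)))
    (point-boundary m S (lookup S 0F) (relative S) (lookup-relative S)))
  (≤-respˡ-≈ (value m (unit m 1 ℕ.+ unit m 1)) (value m (cutCost m 1 (relative S))) 2ℝ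
    (value-unit m) (value-mono m (cost-bound m 1 (relative S) (relative-nonempty S ne pr))))

-- Degree constraints are tight cuts: `later-tight` descends to the level of the vertex. The root is
-- covered by `all-tight`, taken from the other side.
singleton-tight : ∀ m (i : Fin (2 ℕ.+ m ℕ.* 3)) → ∃ λ ζ → Tight m ζ × ∀ j → lookup ⁅ i ⁆ j ≡ ζ j
singleton-tight m       0F = _ , c-tight , λ { zero → refl ; (suc j) → Vec.lookup-replicate j false }
singleton-tight m       1F = _ , u-tight , λ
  { 0F → refl ; 1F → refl ; (suc (suc j)) → Vec.lookup-replicate j false }
singleton-tight (suc m) 2F = _ , v-tight , λ
  { 0F → refl ; 1F → refl ; 2F → refl ; (3+ j) → Vec.lookup-replicate j false }
singleton-tight (suc m) (3+ i) =
  let ζ , t , eq = singleton-tight m i in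
  _ , later-tight t , λ { 0F → refl ; 1F → refl ; 2F → refl ; (3+ j) → eq j }

point-degree : ∀ m v → point m ⟨ δ ⁅ v ⁆ ⟩ ≈ 2ℝ
point-degree m zero    = point-tight m ⁅ zero ⁆ true all-tight λ
  { zero → refl ; (suc i) → Vec.lookup-replicate i false }
point-degree m (suc i) =
  let ζ , t , eq = singleton-tight m i in
  point-tight m ⁅ suc i ⁆ false t λ { zero → refl ; (suc j) → eq j }

point∈polytope : ∀ m → SubtourPolytope (order m) (point m)
point∈polytope m = record
  { degree = point-degree m
  ; cut    = point-cut m
  ; nonneg = λ e → value-mono m {0} {weight m 1 (lo e) (hi e)} z≤n
  }

rootless : ∀ {n} → Vector Bool n → Subset (suc n)
rootless ζ = tabulate (rooted ζ)

tight-nonempty : ∀ {m ζ} → Tight m ζ → ∃ λ i → ζ i ≡ true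
tight-nonempty c-tight     = 0F , refl
tight-nonempty u-tight     = 1F , refl
tight-nonempty v-tight     = 2F , refl
tight-nonempty uv-tight    = 1F , refl
tight-nonempty all-tight   = 0F , refl
tight-nonempty but-c-tight = 1F , refl
tight-nonempty (later-tight t) = let i , eq = tight-nonempty t in suc (suc (suc i)) , eq

tight-cut : ∀ {m ζ y} → SubtourPolytope (order m) y → Tight m ζ → 2ℝ ≤ y ⟨ δ (rootless ζ) ⟩
tight-cut {ζ = ζ} K t = let i , eq = tight-nonempty t in SubtourPolytope.cut K (rootless ζ)
  (suc i , Vec.lookup⇒[]= (suc i) (rootless ζ) (trans (Vec.lookup∘tabulate (rooted ζ) (suc i)) eq))
  (Subset.⊆⊤ , zero , Subset.∈⊤ , λ ())

⟨⟩-linear : ∀ {n} a b (w y z : Edge n → ℝ) A → (∀ e → w e ≈ a * y e + b * z e) →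
  w ⟨ A ⟩ ≈ a * y ⟨ A ⟩ + b * z ⟨ A ⟩
⟨⟩-linear a b w y z A eq = ℝL.total-linear a b (entry y A) (entry z A) (entry w A) entries
  where
  entries : ∀ i j → entry w A i j ≈ a * entry y A i j + b * entry z A i j
  entries i j with i Fin.<? j
  ... | no _ = ℝL.linear-zero a b
  ... | yes i<j with A (edge i j i<j)
  ...   | true  = eq (edge i j i<j)
  ...   | false = ℝL.linear-zero a b

-- The difference from `point m` vanishes off the edges and on all tight cuts, so `rigid` applies to
-- it.
point-unique : ∀ m y → Vanishing m y → (∀ {ζ} → Tight m ζ → y ⟨ δ (rootless ζ) ⟩ ≈ 2ℝ) →
  ∀ e → y e ≈ point m e
point-unique m y vanish tight e = ℝL.difference (y e) (point m e)
  (subst (_≈ 0ℝ) (matrix-edge d e) (entries e))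
  where
  d : Edge (order m) → ℝ
  d e = 1ℝ * y e + (- 1ℝ) * point m e
  d-vanishing : Vanishing m d
  d-vanishing e eq = ℝL.zero-linear 1ℝ (- 1ℝ) {y e} {point m e} (vanish e eq) (point-vanishing m e eq)
  d-tight : ∀ {ζ} → Tight m ζ → ℝC.cost m ζ (matrix d 0F 1F) (matrix d 0F 2F) (matrix d) ≈ 0ℝ
  d-tight {ζ} t = begin
    ℝC.cost m ζ (matrix d 0F 1F) (matrix d 0F 2F) (matrix d)
      ≈⟨ boundary m {d} S false ζ d-vanishing (Vec.lookup∘tabulate (rooted ζ)) ⟨
    d ⟨ δ S ⟩
      ≈⟨ ⟨⟩-linear 1ℝ (- 1ℝ) d y (point m) (δ S) (λ e → ≈-refl (d e)) ⟩
    1ℝ * y ⟨ δ S ⟩ + (- 1ℝ) * point m ⟨ δ S ⟩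
      ≈⟨ ℝL.equal-difference {y ⟨ δ S ⟩} {point m ⟨ δ S ⟩}
           (≈-trans (y ⟨ δ S ⟩) 2ℝ (point m ⟨ δ S ⟩) (tight t)
             (≈-sym (point m ⟨ δ S ⟩) 2ℝ
               (point-tight m S false t (Vec.lookup∘tabulate (rooted ζ))))) ⟩
    0ℝ ∎
    where
    open ≈-Reasoning
    S = rootless ζ
  solution = ℝC.rigid halve m 1 {matrix d 0F 1F} {matrix d 0F 2F} {matrix d}
    (matrix-sparse m {d} d-vanishing) d-tight
  entries : ∀ e → matrix d (lo e) (hi e) ≈ 0ℝ
  entries (edge 0F 0F ())
  entries (edge 0F 1F _) = proj₁ (proj₁ solution)
  entries (edge 0F 2F _) = proj₂ (proj₁ solution)
  entries (edge 0F (3+ j) _) = ℝC._≋_.fromRoot (proj₂ solution) j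
  entries (edge (suc i) 0F ())
  entries (edge (suc i) (suc j) _) = ℝC._≋_.rest (proj₂ solution) i j

-- Zero entries and tight cuts are the inequalities that hold with equality at the point.
-- `pinch-convex` passes these equalities to `y` and `z`, and both must then be the point.
point-extreme : ∀ m → IsExtremePoint (SubtourPolytope (order m)) (point m)
point-extreme m = point∈polytope m , λ y z t Ky Kz 0<t t<1 x≈ →
  let zeros : ∀ e → weight m 1 (lo e) (hi e) ≡ 0 → y e ≈ point m e × z e ≈ point m e
      zeros e eq = pinch-convex t (y e) (z e) (point m e) 0<t t<1
        (≤-respˡ-≈ 0ℝ (y e) (point m e) (≈-sym (point m e) 0ℝ (point-vanishing m e eq))
          (SubtourPolytope.nonneg Ky e))
        (≤-respˡ-≈ 0ℝ (z e) (point m e) (≈-sym (point m e) 0ℝ (point-vanishing m e eq))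
          (SubtourPolytope.nonneg Kz e))
        (x≈ e)
      cuts : ∀ {ζ} → Tight m ζ → let A = δ (rootless ζ) in
        y ⟨ A ⟩ ≈ 2ℝ × z ⟨ A ⟩ ≈ 2ℝ
      cuts {ζ} tight = let A = δ (rootless ζ) in
        pinch-convex t (y ⟨ A ⟩) (z ⟨ A ⟩) 2ℝ 0<t t<1
        (tight-cut {y = y} Ky tight) (tight-cut {y = z} Kz tight)
        (≈-trans 2ℝ (point m ⟨ A ⟩) (t * y ⟨ A ⟩ + (1ℝ - t) * z ⟨ A ⟩)
          (≈-sym (point m ⟨ A ⟩) 2ℝ
            (point-tight m (rootless ζ) false tight (Vec.lookup∘tabulate (rooted ζ))))
          (⟨⟩-linear t (1ℝ - t) (point m) y z A x≈))
  in point-unique m y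
       (λ e eq → ≈-trans (y e) (point m e) 0ℝ (proj₁ (zeros e eq)) (point-vanishing m e eq))
       (λ tight → proj₁ (cuts tight)) ,
     point-unique m z
       (λ e eq → ≈-trans (z e) (point m e) 0ℝ (proj₂ (zeros e eq)) (point-vanishing m e eq))
       (λ tight → proj₂ (cuts tight))

-- Fractionality and degrees

support⇒weight : ∀ m e → Support (point m) e → 1 ℕ.≤ weight m 1 (lo e) (hi e)
support⇒weight m e (ε , 0<ε , N , p) with weight m 1 (lo e) (hi e) | p N ℕ.≤-refl
... | suc _ | _  = s≤s z≤n
... | zero  | ε≤ = contradiction
  (ℚ.<-≤-trans 0<ε (subst (ℚ._≤ 0ℚ) (ℚ.+-identityˡ ε) ε≤)) (ℚ.<-irrefl refl)

weight⇒support : ∀ m e → 1 ℕ.≤ weight m 1 (lo e) (hi e) → Support (point m) e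
weight⇒support m e 1≤w = h , halved-pos m (ℚ.positive⁻¹ 1ℚ) , 0 , λ n _ →
  ℚ.≤-trans (ℚ.≤-reflexive (ℚ.+-comm 0ℚ h)) (·-mono (ℚ.<⇒≤ (halved-pos m (ℚ.positive⁻¹ 1ℚ))) 1≤w)
  where h = halved m 1ℚ

-- Scaled weights are integers, so a positive one is at least 1, and `s u_0` attains 1.
point-fractionality : ∀ m → IsFractionality (point m) (value m 1)
point-fractionality m =
  (e , weight⇒support m e (ℕ.≤-reflexive (sym w≡1)) ,
    pointwise (value m 1) (point m e) λ _ → cong (λ k → seq (value m k) 0) (sym w≡1)) ,
  λ e s → value-mono m (support⇒weight m e s)
  where
  e : Edge (order m)
  e = edge 0F 2F (s≤s z≤n)
  w≡1 : weight m 1 0F 2F ≡ 1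
  w≡1 = weight-02 m 1

-- Positivity is decidable for integer weights. Both orders are added, since at most one of the two
-- entries is nonzero.
adjacent? : ∀ m (v w : Vertex m) → Dec (1 ℕ.≤ weight m 1 v w ℕ.+ weight m 1 w v)
adjacent? m v w = 1 ℕ.≤? weight m 1 v w ℕ.+ weight m 1 w v

neighbours : ∀ m → Vertex m → Subset (order m)
neighbours m v = tabulate λ w → does (adjacent? m v w)

weight⇒< : ∀ m (i j : Vertex m) → 1 ℕ.≤ weight m 1 i j → i Fin.< j
weight⇒< m i j 1≤w = ℕ.≰⇒> λ j≤i → contradiction (subst (1 ℕ.≤_) (weight-≥ m 1 i j j≤i) 1≤w) λ ()

witness : ∀ {P : Set} (P? : Dec P) → does P? ≡ true → P
witness (yes p) _ = p

neighbours-adjacent : ∀ m v w → w ∈ neighbours m v ⇔ Adjacent (Support (point m)) v w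
neighbours-adjacent m v w = mk⇔ to from
  where
  to : w ∈ neighbours m v → Adjacent (Support (point m)) v w
  to w∈ with weight m 1 v w in eq | witness (adjacent? m v w)
    (trans (sym (Vec.lookup∘tabulate (λ w → does (adjacent? m v w)) w)) (Vec.[]=⇒lookup w∈))
  ... | suc _ | _ = let 1≤w = subst (1 ℕ.≤_) (sym eq) (s≤s z≤n)
                        e = edge v w (weight⇒< m v w 1≤w)
                    in e , weight⇒support m e 1≤w , inj₁ (refl , refl)
  ... | zero  | p = let e = edge w v (weight⇒< m w v p) in e , weight⇒support m e p , inj₂ (refl , refl)
  from : Adjacent (Support (point m)) v w → w ∈ neighbours m v
  from (e , s , ends) = Vec.lookup⇒[]= w (neighbours m v)
    (trans (Vec.lookup∘tabulate (λ w → does (adjacent? m v w)) w)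
      (dec-true (adjacent? m v w) (positive ends)))
    where
    positive : _ → 1 ℕ.≤ weight m 1 v w ℕ.+ weight m 1 w v
    positive (inj₁ (refl , refl)) = ℕ.m≤n⇒m≤n+o _ (support⇒weight m e s)
    positive (inj₂ (refl , refl)) = ℕ.m≤n⇒m≤o+n (weight m 1 v w) (support⇒weight m e s)

neighbours-unique : ∀ m v d → HasDegree (Support (point m)) v d → d ≡ ∣ neighbours m v ∣
neighbours-unique m v d (N , N⇔ , eq) = trans (sym eq) (cong ∣_∣ (Subset.⊆-antisym
  (λ {w} w∈ → Equivalence.from (neighbours-adjacent m v w) (Equivalence.to (N⇔ w) w∈))
  (λ {w} w∈ → Equivalence.from (N⇔ w) (Equivalence.to (neighbours-adjacent m v w) w∈))))

maximum : ∀ {n} (f : Fin (suc n) → ℕ) → ∃ λ v → ∀ w → f w ℕ.≤ f v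
maximum {zero}  f = zero , λ { zero → ℕ.≤-refl }
maximum {suc n} f with maximum (λ i → f (suc i))
... | v , max with ℕ.≤-total (f zero) (f (suc v))
...   | inj₁ f0≤ = suc v , λ { zero → f0≤ ; (suc w) → max w }
...   | inj₂ ≤f0 = zero , λ { zero → ℕ.≤-refl ; (suc w) → ℕ.≤-trans (max w) ≤f0 }

root-size : ∀ m A (f : Fin (m ℕ.* 3) → Bool) → 1 ℕ.≤ A →
  (∀ j → 1 ℕ.≤ weight m A 0F (3+ j) → f j ≡ true) → m ℕ.≤ ∣ tabulate f ∣
root-size zero    A f 1≤A p = z≤n
-- The indices 0, 1, 2 of `f` are `v_0`, `c_1`, `u_1`; each level contributes the neighbour at index
-- 1.
root-size (suc m) A f 1≤A p rewrite p 1F 1≤A = ℕ.≤-trans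
  (s≤s (ℕ.≤-trans
    (root-size m (A ℕ.+ A) _ (ℕ.m≤n⇒m≤n+o A 1≤A) λ j → p (3+ j))
    (Subset.∣p∣≤∣x∷p∣ (f 2F) (tabulate λ j → f (3+ j)))))
  (Subset.∣p∣≤∣x∷p∣ (f 0F) (true Vec.∷ f 2F Vec.∷ tabulate λ j → f (3+ j)))

size-tail : ∀ {n} (f : Fin (suc n) → Bool) → ∣ tabulate (λ j → f (suc j)) ∣ ℕ.≤ ∣ tabulate f ∣
size-tail f = Subset.∣p∣≤∣x∷p∣ (f zero) (tabulate λ j → f (suc j))

root-degree : ∀ m → m ℕ.≤ ∣ neighbours m 0F ∣
root-degree m = ℕ.≤-trans
  (root-size m 1 (λ j → f (3+ j)) ℕ.≤-refl λ j 1≤w →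
    dec-true (adjacent? m 0F (3+ j)) (ℕ.m≤n⇒m≤n+o _ 1≤w))
  (ℕ.≤-trans (size-tail λ j → f (suc (suc j))) (ℕ.≤-trans (size-tail λ j → f (suc j)) (size-tail f)))
  where
  f : Vertex m → Bool
  f w = does (adjacent? m 0F w)

max-degree : ∀ m → ∃ λ Δ → IsMaxDegree (Support (point m)) Δ × m ℕ.≤ Δ
max-degree m with maximum (λ v → ∣ neighbours m v ∣)
... | v , max = ∣ neighbours m v ∣ ,
  ((v , neighbours m v , neighbours-adjacent m v , refl) ,
   λ w d deg → ℕ.≤-trans (ℕ.≤-reflexive (neighbours-unique m w d deg)) (max w)) ,
  ℕ.≤-trans (root-degree m) (max 0F)

-- Since ½ ≤ ρ³, the powers ρ^n dominate 2^(-n/3).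
ρ : ℝ
ρ = recip (fromℚ (+ 5 ℚ./ 4))
  (1<⇒0< (fromℚ (+ 5 ℚ./ 4)) (+ 1 ℚ./ 4 , ℚ.positive⁻¹ _ , 0 , λ _ _ → ℚ.≤-refl))

ratio : ℚ
ratio = inv (+ 5 ℚ./ 4)

-- All powers of `ρ` are constant sequences, so any one term represents them.
ratio^_ : ℕ → ℚ
ratio^ n = seq (ρ ^ n) 0

ratio^-nonneg : ∀ n → 0ℚ ℚ.≤ ratio^ n
ratio^-nonneg zero    = ℚ.nonNegative⁻¹ 1ℚ
ratio^-nonneg (suc n) = ℚ.≤-trans (ℚ.≤-reflexive (sym (ℚ.*-zeroʳ ratio)))
  (ℚ.*-monoˡ-≤-nonNeg ratio (ratio^-nonneg n))

halved-bound : ∀ m q → 0ℚ ℚ.≤ q → halved m q ℚ.≤ q ℚ.* ratio^ (m ℕ.* 3)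
halved-bound zero    q 0≤q = ℚ.≤-reflexive (sym (ℚ.*-identityʳ q))
halved-bound (suc m) q 0≤q = ℚ.≤-trans (halved-bound m (½ ℚ.* q)
  (ℚ.≤-trans (ℚ.≤-reflexive (sym (ℚ.*-zeroʳ ½))) (ℚ.*-monoˡ-≤-nonNeg ½ 0≤q)))
  (begin
    (½ ℚ.* q) ℚ.* P
      ≡⟨ solve 3 (λ h q p → (h :* q) :* p := h :* (q :* p)) refl ½ q P ⟩
    ½ ℚ.* (q ℚ.* P)
      ≤⟨ ℚ.*-monoʳ-≤-nonNeg (q ℚ.* P) {{ℚ.nonNegative 0≤qP}}
           -- `(4/5)^3 = 64/125`, just above one half: three vertices per halving.
           (from-yes (½ ℚ.≤? ratio ℚ.* (ratio ℚ.* ratio))) ⟩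
    (ratio ℚ.* (ratio ℚ.* ratio)) ℚ.* (q ℚ.* P)
      ≡⟨ solve 3 (λ r q p → (r :* (r :* r)) :* (q :* p) := q :* (r :* (r :* (r :* p))))
           refl ratio q P ⟩
    q ℚ.* (ratio ℚ.* (ratio ℚ.* (ratio ℚ.* P))) ∎)
  where
  open ℚ.≤-Reasoning
  P = ratio^ (m ℕ.* 3)
  0≤qP : 0ℚ ℚ.≤ q ℚ.* P
  0≤qP = ℚ.≤-trans (ℚ.≤-reflexive (sym (ℚ.*-zeroʳ q)))
    (ℚ.*-monoˡ-≤-nonNeg q {{ℚ.nonNegative 0≤q}} (ratio^-nonneg (m ℕ.* 3)))

fractionality-bound : ∀ m → value m 1 ≤ 2ℝ * (ρ ^ order m)
fractionality-bound m = pointwise-≤ (value m 1) (2ℝ * (ρ ^ order m)) λ n →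
  subst (halved m 1ℚ ℚ.+ 0ℚ ℚ.≤_) (sym (cong
    (λ p → (+ 2 ℚ./ 1) ℚ.* (ratio ℚ.* (ratio ℚ.* (ratio ℚ.* p)))) (constant (m ℕ.* 3) n))) (begin
    halved m 1ℚ ℚ.+ 0ℚ           ≡⟨ ℚ.+-identityʳ (halved m 1ℚ) ⟩
    halved m 1ℚ                  ≤⟨ halved-bound m 1ℚ (ℚ.nonNegative⁻¹ 1ℚ) ⟩
    1ℚ ℚ.* P
      ≤⟨ ℚ.*-monoʳ-≤-nonNeg P {{ℚ.nonNegative (ratio^-nonneg (m ℕ.* 3))}}
           -- The constant 2 pays for the three vertices of the triangle: `2 (4/5)^3 = 128/125`.
           (from-yes (1ℚ ℚ.≤? (+ 2 ℚ./ 1) ℚ.* (ratio ℚ.* (ratio ℚ.* ratio)))) ⟩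
    ((+ 2 ℚ./ 1) ℚ.* (ratio ℚ.* (ratio ℚ.* ratio))) ℚ.* P
      ≡⟨ solve 3 (λ t r p → (t :* (r :* (r :* r))) :* p := t :* (r :* (r :* (r :* p))))
           refl (+ 2 ℚ./ 1) ratio P ⟩
    (+ 2 ℚ./ 1) ℚ.* (ratio ℚ.* (ratio ℚ.* (ratio ℚ.* P))) ∎)
  where
  open ℚ.≤-Reasoning
  P = ratio^ (m ℕ.* 3)
  constant : ∀ k n → seq (ρ ^ k) n ≡ ratio^ k
  constant zero    n = refl
  constant (suc k) n = cong (ratio ℚ.*_) (constant k n)

-- Normalisation of `+ n ℚ./ 1` is stuck on a variable `n`; in unnormalised rationals the claim is
-- an inequality of integers.
sixth-bound : ∀ n d → n ℕ.≤ 6 ℕ.* d → fromℚ (+ 1 ℚ./ 6) * fromℕ n ≤ fromℕ d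
sixth-bound n d n≤6d = pointwise-≤ (fromℚ (+ 1 ℚ./ 6) * fromℕ n) (fromℕ d) λ _ → ℚ.toℚᵘ-cancel-≤ (begin
  ℚ.toℚᵘ (+ 1 ℚ./ 6 ℚ.* (+ n ℚ./ 1))            ≃⟨ ℚ.toℚᵘ-homo-* (+ 1 ℚ./ 6) (+ n ℚ./ 1) ⟩
  mkℚᵘ (+ 1) 5 ℚᵘ.* ℚ.toℚᵘ (+ n ℚ./ 1)
    ≃⟨ ℚᵘ.*-congˡ {mkℚᵘ (+ 1) 5} (ℚ.toℚᵘ-fromℚᵘ (mkℚᵘ (+ n) 0)) ⟩
  mkℚᵘ (+ 1) 5 ℚᵘ.* mkℚᵘ (+ n) 0                ≤⟨ ℚᵘ.*≤* (subst₂ ℤ._≤_ left right (ℤ.+≤+ n≤6d)) ⟩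
  mkℚᵘ (+ d) 0                                  ≃⟨ ℚ.toℚᵘ-fromℚᵘ (mkℚᵘ (+ d) 0) ⟨
  ℚ.toℚᵘ (+ d ℚ./ 1)                            ∎)
  where
  open ℚᵘ.≤-Reasoning
  open ≡ using (subst₂)
  left : + n ≡ ((+ 1) ℤ.* (+ n)) ℤ.* (+ 1)
  left = sym (trans (ℤ.*-identityʳ ((+ 1) ℤ.* (+ n))) (ℤ.*-identityˡ (+ n)))
  right : + (6 ℕ.* d) ≡ (+ d) ℤ.* (+ 6)
  right = trans (cong (+_) (ℕ.*-comm 6 d)) (ℤ.pos-* d 6)

order-bound : ∀ m {d} → suc m ℕ.≤ d → order (suc m) ℕ.≤ 6 ℕ.* d
order-bound m {d} m<d = ℕ.≤-trans
  (ℕ.≤-trans (ℕ.m≤m+n (order (suc m)) (m ℕ.* 3)) (ℕ.≤-reflexive (lemma m)))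
  (ℕ.*-monoʳ-≤ 6 m<d)
  where
  lemma : ∀ m → 6 ℕ.+ m ℕ.* 3 ℕ.+ m ℕ.* 3 ≡ 6 ℕ.* suc m
  lemma = solve-∀

theorem4 : ∃ λ (C : ℝ) → ∃ λ (α : ℝ) → ∃ λ (β : ℝ) →
    0ℝ < C × (Σ (1ℝ < α) λ 1<α → 0ℝ < β ×
    (∀ (N : ℕ) → ∃ λ (n : ℕ) → N ℕ.< n ×
    (∃ λ (x : Edge n → ℝ) →
    IsExtremePoint (SubtourPolytope n) x
    × (∃ λ (f : ℝ) → IsFractionality x f
    × f ≤ C * (recip α (1<⇒0< α 1<α) ^ n))
    × (∃ λ (Δ : ℕ) → IsMaxDegree (Support x) Δ
    × β * fromℕ n ≤ fromℕ Δ))))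
theorem4 = 2ℝ , fromℚ (+ 5 ℚ./ 4) , fromℚ (+ 1 ℚ./ 6) ,
  (1ℚ , ℚ.positive⁻¹ 1ℚ , 0 , λ _ _ → from-yes (0ℚ ℚ.+ 1ℚ ℚ.≤? + 2 ℚ./ 1)) ,
  (+ 1 ℚ./ 4 , ℚ.positive⁻¹ _ , 0 , λ _ _ → ℚ.≤-refl) ,
  (+ 1 ℚ./ 6 , ℚ.positive⁻¹ _ , 0 , λ _ _ → ℚ.≤-refl) , λ N →
  -- At least one level is taken: the bound `m ≤ Δ` yields `3m + 3 ≤ 6 Δ`, the source of the factor
  -- 1/6, only for positive `m`.
  let m = suc N
      Δ , isMax , m≤Δ = max-degree m
  in order m , s≤s (ℕ.m≤n⇒m≤o+n 5 (ℕ.m≤m*n N 3)) , point m , point-extreme m ,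
     (value m 1 , point-fractionality m , fractionality-bound m) ,
     Δ , isMax , sixth-bound (order m) Δ (order-bound N m≤Δ)
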